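{- Let $v\in\mathbb{Z}^3$ be primitive with integral Euclidean length. Then there exists exactly one cubic sublattice $C$ of $\mathbb{Z}^3$ containing $v$ as a shortest nonzero vector.
   Context: A vector is primitive if the gcd of its components is $1$. A cubic sublattice of $\mathbb{Z}^3$ is the subgroup generated by three nonzero pairwise orthogonal vectors of $\mathbb{Z}^3$ of equal length. -}

module Defs where

open import Data.Nat using (ℕ)
import Data.Nat as ℕ
open import Data.Nat.GCD using (gcd)
open import Data.Integer using (ℤ; +_; _+_; _*_; ∣_∣; _≤_)
open import Data.Product using (_×_; _,_; Σ; ∃; ∃-syntax)
open import Relation.Binary.PropositionalEquality using (_≡_; _≢_)

record ℤ³ : Set where
  constructor ⟨_,_,_⟩
  field
    x₁ x₂ x₃ : ℤ
open ℤ³ public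

0ᵥ : ℤ³
0ᵥ = ⟨ + 0 , + 0 , + 0 ⟩

_+ᵥ_ : ℤ³ → ℤ³ → ℤ³
⟨ a , b , c ⟩ +ᵥ ⟨ d , e , f ⟩ = ⟨ a + d , b + e , c + f ⟩

_·ᵥ_ : ℤ → ℤ³ → ℤ³
k ·ᵥ ⟨ a , b , c ⟩ = ⟨ k * a , k * b , k * c ⟩

dot : ℤ³ → ℤ³ → ℤ
dot ⟨ a , b , c ⟩ ⟨ d , e , f ⟩ = a * d + b * e + c * f

norm² : ℤ³ → ℤ
norm² v = dot v v

Primitive : ℤ³ → Set
Primitive ⟨ a , b , c ⟩ = gcd (gcd ∣ a ∣ ∣ b ∣) ∣ c ∣ ≡ 1

IntegralLength : ℤ³ → Set
IntegralLength v = ∃[ n ] norm² v ≡ + (n ℕ.* n)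

record CubicFrame : Set where
  field
    u₁ u₂ u₃ : ℤ³
    u₁≢0 : u₁ ≢ 0ᵥ
    u₂≢0 : u₂ ≢ 0ᵥ
    u₃≢0 : u₃ ≢ 0ᵥ
    u₁⊥u₂ : dot u₁ u₂ ≡ + 0
    u₁⊥u₃ : dot u₁ u₃ ≡ + 0
    u₂⊥u₃ : dot u₂ u₃ ≡ + 0
    |u₁|≡|u₂| : norm² u₁ ≡ norm² u₂
    |u₁|≡|u₃| : norm² u₁ ≡ norm² u₃
open CubicFrame public

_∈ᶜ_ : ℤ³ → CubicFrame → Set
x ∈ᶜ F = ∃[ a ] ∃[ b ] ∃[ c ] x ≡ (a ·ᵥ u₁ F) +ᵥ ((b ·ᵥ u₂ F) +ᵥ (c ·ᵥ u₃ F))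

ShortestIn : ℤ³ → CubicFrame → Set
ShortestIn v F = v ∈ᶜ F × v ≢ 0ᵥ × (∀ x → x ∈ᶜ F → x ≢ 0ᵥ → norm² v ≤ norm² x)

SameLattice : CubicFrame → CubicFrame → Set
SameLattice F G = ∀ x → (x ∈ᶜ F → x ∈ᶜ G) × (x ∈ᶜ G → x ∈ᶜ F)

-- By parity, a primitive v with |v| = n has, up to a cyclic shift of coordinates, v₁ and n odd
-- and v₂, v₃ even. Such a v is the image (|α|² − |β|², 2αβ̄) of a pair of coprime Gaussian integers
-- with |α|² + |β|² = n; these are found by descent along the reflection of the form
-- a² + b² + c² − n² in (1, 1, 1, 1), which lowers n as long as a, b, c ≥ 0 and a + b + c > n.
-- From (α, β) one writes down w₁, w₂ completing v to an orthogonal frame of common norm n²,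
-- together with L, M such that (L + iM)·(w₁ + iw₂) = 2. Since n is odd, this pairing forces every
-- integral vector of norm n² orthogonal to v to be ±w₁ or ±w₂. If v is a shortest vector of a cubic
-- lattice with generators gᵢ of norm m, then n² = m(a² + b² + c²) and n² ≤ m give v = ±gᵢ; the
-- other two generators are orthogonal to v of norm n², hence ±w₁ and ±w₂.

{-# OPTIONS --safe #-}
module Submission where

open import Defs
open import Data.Empty using (⊥-elim)
open import Data.Integer as ℤ using (ℤ; +_; -[1+_]; _+_; _*_; -_; _-_; ∣_∣; 0ℤ; 1ℤ; -1ℤ; NonZero)
import Data.Integer.Properties as ℤₚ
open ℤₚ using (∣i∣≡0⇒i≡0)
open import Data.Integer.Divisibility.Signed
  using (_∣_; divides; _∣?_; ∣⇒∣ᵤ; ∣ᵤ⇒∣; ∣-refl; ∣m∣n⇒∣m+n; ∣m∣n⇒∣m-n; ∣m⇒∣-m; ∣m⇒∣m*n; ∣n⇒∣m*n)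
open import Data.Integer.DivMod using (_%ℕ_; _/ℕ_; a≡a%ℕn+[a/ℕn]*n; n%ℕd<d)
open import Data.Integer.Tactic.RingSolver using (solve-∀)
open import Data.Nat as ℕ using (ℕ; zero; suc; z≤n; s≤s)
import Data.Nat.Properties as ℕₚ
import Data.Nat.Divisibility as ℕᵈ
import Data.Nat.GCD as ℕᵍ
import Data.Nat.Coprimality as ℕᶜ
import Data.Nat.Tactic.RingSolver as ℕRing
open import Data.Nat.Induction using (<-rec)
open import Data.Product using (_×_; _,_; ∃-syntax; proj₁; proj₂)
open import Data.Sum using (_⊎_; inj₁; inj₂; [_,_]′)
open import Function using (_∘_)
open import Level using (0ℓ)
open import Relation.Binary.PropositionalEquality
open import Relation.Nullary using (¬_; yes; no)
open import Relation.Nullary.Decidable using (False; toWitnessFalse)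
open import Relation.Unary using (Pred; _⊆_; _≐_)
open import Relation.Unary.Properties using (≐-trans; ≐-sym)

-- Arithmetic of ℕ and ℤ

2*m*n≤m*m+n*n : ∀ m n → 2 ℕ.* (m ℕ.* n) ℕ.≤ m ℕ.* m ℕ.+ n ℕ.* n
2*m*n≤m*m+n*n m n = [ ordered , swapped ]′ (ℕₚ.≤-total m n)
  where
  ordered : ∀ {m n} → m ℕ.≤ n → 2 ℕ.* (m ℕ.* n) ℕ.≤ m ℕ.* m ℕ.+ n ℕ.* n
  ordered {m} m≤n with ℕₚ.m≤n⇒∃[o]m+o≡n m≤n
  ... | d , refl = subst (2 ℕ.* (m ℕ.* (m ℕ.+ d)) ℕ.≤_) (gap m d) (ℕₚ.m≤m+n _ (d ℕ.* d))
    where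
    gap : ∀ m d → 2 ℕ.* (m ℕ.* (m ℕ.+ d)) ℕ.+ d ℕ.* d ≡ m ℕ.* m ℕ.+ (m ℕ.+ d) ℕ.* (m ℕ.+ d)
    gap = ℕRing.solve-∀
  swapped : n ℕ.≤ m → 2 ℕ.* (m ℕ.* n) ℕ.≤ m ℕ.* m ℕ.+ n ℕ.* n
  swapped n≤m = subst₂ ℕ._≤_ (cong (2 ℕ.*_) (ℕₚ.*-comm n m)) (ℕₚ.+-comm (n ℕ.* n) (m ℕ.* m)) (ordered n≤m)

m*m≤n*n⇒m≤n : ∀ {m n} → m ℕ.* m ℕ.≤ n ℕ.* n → m ℕ.≤ n
m*m≤n*n⇒m≤n m*m≤n*n = ℕₚ.≮⇒≥ λ n<m → ℕₚ.<⇒≱ (ℕₚ.*-mono-< n<m n<m) m*m≤n*n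

m*m≡n*n⇒m≡n : ∀ {m n} → m ℕ.* m ≡ n ℕ.* n → m ≡ n
m*m≡n*n⇒m≡n eq = ℕₚ.≤-antisym (m*m≤n*n⇒m≤n (ℕₚ.≤-reflexive eq)) (m*m≤n*n⇒m≤n (ℕₚ.≤-reflexive (sym eq)))

a+b+c≤2*n : ∀ {a b c n} → a ℕ.* a ℕ.+ b ℕ.* b ℕ.+ c ℕ.* c ≡ n ℕ.* n → a ℕ.+ b ℕ.+ c ℕ.≤ 2 ℕ.* n
a+b+c≤2*n {a} {b} {c} {n} eq = m*m≤n*n⇒m≤n (begin
  (a ℕ.+ b ℕ.+ c) ℕ.* (a ℕ.+ b ℕ.+ c)                           ≡⟨ expand a b c ⟩
  Q ℕ.+ (2 ℕ.* (a ℕ.* b) ℕ.+ 2 ℕ.* (b ℕ.* c) ℕ.+ 2 ℕ.* (c ℕ.* a))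
    ≤⟨ ℕₚ.+-monoʳ-≤ Q (ℕₚ.+-mono-≤ (ℕₚ.+-mono-≤ (2*m*n≤m*m+n*n a b) (2*m*n≤m*m+n*n b c)) (2*m*n≤m*m+n*n c a)) ⟩
  Q ℕ.+ ((a ℕ.* a ℕ.+ b ℕ.* b) ℕ.+ (b ℕ.* b ℕ.+ c ℕ.* c) ℕ.+ (c ℕ.* c ℕ.+ a ℕ.* a)) ≡⟨ regroup a b c ⟩
  3 ℕ.* Q                                                      ≡⟨ cong (3 ℕ.*_) eq ⟩
  3 ℕ.* (n ℕ.* n)                                              ≤⟨ ℕₚ.m≤m+n (3 ℕ.* (n ℕ.* n)) (n ℕ.* n) ⟩
  3 ℕ.* (n ℕ.* n) ℕ.+ n ℕ.* n                                  ≡⟨ four n ⟩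
  (2 ℕ.* n) ℕ.* (2 ℕ.* n)                                      ∎)
  where
  open ℕₚ.≤-Reasoning
  Q = a ℕ.* a ℕ.+ b ℕ.* b ℕ.+ c ℕ.* c
  expand : ∀ a b c → (a ℕ.+ b ℕ.+ c) ℕ.* (a ℕ.+ b ℕ.+ c)
         ≡ (a ℕ.* a ℕ.+ b ℕ.* b ℕ.+ c ℕ.* c) ℕ.+ (2 ℕ.* (a ℕ.* b) ℕ.+ 2 ℕ.* (b ℕ.* c) ℕ.+ 2 ℕ.* (c ℕ.* a))
  expand = ℕRing.solve-∀
  regroup : ∀ a b c → (a ℕ.* a ℕ.+ b ℕ.* b ℕ.+ c ℕ.* c) ℕ.+ ((a ℕ.* a ℕ.+ b ℕ.* b) ℕ.+ (b ℕ.* b ℕ.+ c ℕ.* c) ℕ.+ (c ℕ.* c ℕ.+ a ℕ.* a))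
          ≡ 3 ℕ.* (a ℕ.* a ℕ.+ b ℕ.* b ℕ.+ c ℕ.* c)
  regroup = ℕRing.solve-∀
  four : ∀ n → 3 ℕ.* (n ℕ.* n) ℕ.+ n ℕ.* n ≡ (2 ℕ.* n) ℕ.* (2 ℕ.* n)
  four = ℕRing.solve-∀

n≡m*s∧n≤m⇒s≡1 : ∀ {n m s} → n ≢ 0 → n ≡ m ℕ.* s → n ℕ.≤ m → s ≡ 1
n≡m*s∧n≤m⇒s≡1 {m = m} {zero} n≢0 n≡m*0 _ = ⊥-elim (n≢0 (trans n≡m*0 (ℕₚ.*-zeroʳ m)))
n≡m*s∧n≤m⇒s≡1 {s = suc zero} _ _ _ = refl
n≡m*s∧n≤m⇒s≡1 {n} {m} {suc (suc s)} n≢0 refl n≤m = ⊥-elim (ℕₚ.<⇒≱ (ℕₚ.m<m*n m (2 ℕ.+ s) ⦃ m≢0 ⦄ (s≤s (s≤s z≤n))) n≤m)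
  where
  m≢0 : ℕ.NonZero m
  m≢0 = ℕ.≢-nonZero λ { refl → n≢0 refl }

m*m∣n*n⇒m∣n : ∀ {m n} → m ℕ.* m ℕᵈ.∣ n ℕ.* n → m ℕᵈ.∣ n
m*m∣n*n⇒m∣n {zero} {n} 0∣n*n with ℕₚ.m*n≡0⇒m≡0∨n≡0 n (ℕᵈ.0∣⇒≡0 0∣n*n)
... | inj₁ refl = ℕᵈ.∣-refl
... | inj₂ refl = ℕᵈ.∣-refl
m*m∣n*n⇒m∣n {m@(suc _)} {n} m*m∣n*n = subst (ℕᵈ._∣ n) (sym m≡g) (ℕᵍ.gcd[m,n]∣n m n)
  where
  g = ℕᵍ.gcd m n
  instance
    g≢0 : ℕ.NonZero g
    g≢0 = ℕ.≢-nonZero (ℕᵍ.gcd[m,n]≢0 m n (inj₁ λ ()))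
  m′ = ℕᵈ._∣_.quotient (ℕᵍ.gcd[m,n]∣m m n)
  n′ = ℕᵈ._∣_.quotient (ℕᵍ.gcd[m,n]∣n m n)
  m≡m′g : m ≡ m′ ℕ.* g
  m≡m′g = ℕᵈ._∣_.equality (ℕᵍ.gcd[m,n]∣m m n)
  n≡n′g : n ≡ n′ ℕ.* g
  n≡n′g = ℕᵈ._∣_.equality (ℕᵍ.gcd[m,n]∣n m n)
  gcd[m′,n′]≡1 : ℕᵍ.gcd m′ n′ ≡ 1
  gcd[m′,n′]≡1 = ℕₚ.*-cancelˡ-≡ _ 1 g (begin
    g ℕ.* ℕᵍ.gcd m′ n′              ≡⟨ ℕᵍ.c*gcd[m,n]≡gcd[cm,cn] g m′ n′ ⟩
    ℕᵍ.gcd (g ℕ.* m′) (g ℕ.* n′)    ≡⟨ cong₂ ℕᵍ.gcd (trans (ℕₚ.*-comm g m′) (sym m≡m′g)) (trans (ℕₚ.*-comm g n′) (sym n≡n′g)) ⟩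
    g                               ≡⟨ ℕₚ.*-identityʳ g ⟨
    g ℕ.* 1                         ∎)
    where open ≡-Reasoning
  square : ∀ x g → (x ℕ.* g) ℕ.* (x ℕ.* g) ≡ (g ℕ.* g) ℕ.* (x ℕ.* x)
  square = ℕRing.solve-∀
  m′∣n′*n′ : m′ ℕᵈ.∣ n′ ℕ.* n′
  m′∣n′*n′ = ℕᵈ.∣-trans (ℕᵈ.m∣m*n m′) (ℕᵈ.*-cancelˡ-∣ (g ℕ.* g) ⦃ ℕₚ.m*n≢0 g g ⦄
    (subst₂ ℕᵈ._∣_ (trans (cong₂ ℕ._*_ m≡m′g m≡m′g) (square m′ g)) (trans (cong₂ ℕ._*_ n≡n′g n≡n′g) (square n′ g)) m*m∣n*n))
  m′≡1 : m′ ≡ 1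
  m′≡1 = ℕᵈ.∣1⇒≡1 (subst (m′ ℕᵈ.∣_) gcd[m′,n′]≡1
           (ℕᵍ.gcd-greatest ℕᵈ.∣-refl (ℕᶜ.coprime-divisor (ℕᶜ.gcd≡1⇒coprime gcd[m′,n′]≡1) m′∣n′*n′)))
  m≡g : m ≡ g
  m≡g = trans m≡m′g (trans (cong (ℕ._* g) m′≡1) (ℕₚ.*-identityˡ g))

x*x+y*y+z*z≡1 : ∀ {x y z} → x ℕ.* x ℕ.+ y ℕ.* y ℕ.+ z ℕ.* z ≡ 1 →
  (x ≡ 1 × y ≡ 0 × z ≡ 0) ⊎ (x ≡ 0 × y ≡ 1 × z ≡ 0) ⊎ (x ≡ 0 × y ≡ 0 × z ≡ 1)
x*x+y*y+z*z≡1 {1}         {0}         {0}         _ = inj₁ (refl , refl , refl)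
x*x+y*y+z*z≡1 {0}         {1}         {0}         _ = inj₂ (inj₁ (refl , refl , refl))
x*x+y*y+z*z≡1 {0}         {0}         {1}         _ = inj₂ (inj₂ (refl , refl , refl))
x*x+y*y+z*z≡1 {0}         {0}         {0}         ()
x*x+y*y+z*z≡1 {0}         {0}         {suc (suc _)} ()
x*x+y*y+z*z≡1 {0}         {1}         {suc _}     ()
x*x+y*y+z*z≡1 {0}         {suc (suc _)} {_}       ()
x*x+y*y+z*z≡1 {1}         {0}         {suc _}     ()
x*x+y*y+z*z≡1 {1}         {suc _}     {_}         ()
x*x+y*y+z*z≡1 {suc (suc _)} {_}       {_}         ()

2ℤ : ℤ
2ℤ = + 2

i*i∣j*j⇒i∣j : ∀ {i j} → i * i ∣ j * j → i ∣ j
i*i∣j*j⇒i∣j {i} {j} i*i∣j*j =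
  ∣ᵤ⇒∣ (m*m∣n*n⇒m∣n (subst₂ ℕᵈ._∣_ (ℤₚ.abs-* i i) (ℤₚ.abs-* j j) (∣⇒∣ᵤ i*i∣j*j)))

∣-i⇒∣i : ∀ {d i} → d ∣ - i → d ∣ i
∣-i⇒∣i {i = i} d∣-i = subst (_ ∣_) (ℤₚ.neg-involutive i) (∣m⇒∣-m d∣-i)

-i*-i≡i*i : ∀ i → - i * - i ≡ i * i
-i*-i≡i*i = solve-∀

2∤1 : ¬ (2ℤ ∣ 1ℤ)
2∤1 = toWitnessFalse {a? = 2ℤ ∣? 1ℤ} _

2*i+1≢0 : ∀ i → 2ℤ * i + 1ℤ ≢ 0ℤ
2*i+1≢0 i eq = 2∤1 (divides (- i) (begin
  1ℤ                        ≡⟨ shift i ⟩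
  - i * 2ℤ + (2ℤ * i + 1ℤ)  ≡⟨ cong (_+_ (- i * 2ℤ)) eq ⟩
  - i * 2ℤ + 0ℤ             ≡⟨ ℤₚ.+-identityʳ _ ⟩
  - i * 2ℤ                  ∎))
  where
  open ≡-Reasoning
  shift : ∀ i → 1ℤ ≡ - i * 2ℤ + (2ℤ * i + 1ℤ)
  shift = solve-∀

odd∣2*i⇒∣i : ∀ m {i} → 2ℤ * m + 1ℤ ∣ 2ℤ * i → 2ℤ * m + 1ℤ ∣ i
odd∣2*i⇒∣i m {i} N∣2i = subst (_ ∣_) (bézout m i) (∣m∣n⇒∣m-n (∣m⇒∣m*n i ∣-refl) (∣n⇒∣m*n m N∣2i))
  where
  bézout : ∀ m i → (2ℤ * m + 1ℤ) * i - m * (2ℤ * i) ≡ i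
  bézout = solve-∀

Unit : ℤ → Set
Unit i = i ≡ 1ℤ ⊎ i ≡ -1ℤ

∣i∣≡1⇒Unit : ∀ {i} → ∣ i ∣ ≡ 1 → Unit i
∣i∣≡1⇒Unit {+ .1}     refl = inj₁ refl
∣i∣≡1⇒Unit { -[1+ 0 ]} refl = inj₂ refl

Even Odd : ℤ → Set
Even i = ∃[ q ] i ≡ 2ℤ * q
Odd i = ∃[ q ] i ≡ 2ℤ * q + 1ℤ

Even⇒2∣ : ∀ {i} → Even i → 2ℤ ∣ i
Even⇒2∣ (q , i≡2q) = divides q (trans i≡2q (ℤₚ.*-comm 2ℤ q))

parity : ∀ i → Even i ⊎ Odd i
parity i with i %ℕ 2 | a≡a%ℕn+[a/ℕn]*n i 2 | n%ℕd<d i 2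
... | 0           | i≡0+q*2 | _ = inj₁ (i /ℕ 2 , trans i≡0+q*2 (even-form (i /ℕ 2)))
  where
  even-form : ∀ q → 0ℤ + q * 2ℤ ≡ 2ℤ * q
  even-form = solve-∀
... | 1           | i≡1+q*2 | _ = inj₂ (i /ℕ 2 , trans i≡1+q*2 (odd-form (i /ℕ 2)))
  where
  odd-form : ∀ q → 1ℤ + q * 2ℤ ≡ 2ℤ * q + 1ℤ
  odd-form = solve-∀
... | suc (suc _) | _       | s≤s (s≤s ())

residue : ∀ {i} → Even i ⊎ Odd i → ℤ
residue (inj₁ _) = 0ℤ
residue (inj₂ _) = 1ℤ

square-mod-4 : ∀ {i} (p : Even i ⊎ Odd i) → ∃[ k ] i * i ≡ + 4 * k + residue p
square-mod-4 (inj₁ (q , refl)) = q * q , square q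
  where
  square : ∀ q → 2ℤ * q * (2ℤ * q) ≡ + 4 * (q * q) + 0ℤ
  square = solve-∀
square-mod-4 (inj₂ (q , refl)) = q * q + q , square q
  where
  square : ∀ q → (2ℤ * q + 1ℤ) * (2ℤ * q + 1ℤ) ≡ + 4 * (q * q + q) + 1ℤ
  square = solve-∀

residues-balance : ∀ {a b c n} (pa : Even a ⊎ Odd a) (pb : Even b ⊎ Odd b) (pc : Even c ⊎ Odd c) (pn : Even n ⊎ Odd n) →
  a * a + b * b + c * c ≡ n * n → + 4 ∣ residue pn - (residue pa + residue pb + residue pc)
residues-balance {a} {b} {c} {n} pa pb pc pn eq
  with ka , a² ← square-mod-4 pa | kb , b² ← square-mod-4 pb | kc , c² ← square-mod-4 pc | kn , n² ← square-mod-4 pn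
  = divides (ka + kb + kc - kn) (begin
    rn - (ra + rb + rc)
      ≡⟨ regroup ka kb kc kn ra rb rc rn ⟩
    (ka + kb + kc - kn) * + 4 + ((+ 4 * kn + rn) - ((+ 4 * ka + ra) + (+ 4 * kb + rb) + (+ 4 * kc + rc)))
      ≡⟨ cong₂ (λ x y → (ka + kb + kc - kn) * + 4 + (x - y)) n² (cong₂ _+_ (cong₂ _+_ a² b²) c²) ⟨
    (ka + kb + kc - kn) * + 4 + (n * n - (a * a + b * b + c * c))
      ≡⟨ cong (λ x → (ka + kb + kc - kn) * + 4 + (n * n - x)) eq ⟩
    (ka + kb + kc - kn) * + 4 + (n * n - n * n)
      ≡⟨ cancel ((ka + kb + kc - kn) * + 4) (n * n) ⟩
    (ka + kb + kc - kn) * + 4 ∎)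
  where
  open ≡-Reasoning
  ra = residue pa
  rb = residue pb
  rc = residue pc
  rn = residue pn
  regroup : ∀ ka kb kc kn ra rb rc rn → rn - (ra + rb + rc)
          ≡ (ka + kb + kc - kn) * + 4 + ((+ 4 * kn + rn) - ((+ 4 * ka + ra) + (+ 4 * kb + rb) + (+ 4 * kc + rc)))
  regroup = solve-∀
  cancel : ∀ x y → x + (y - y) ≡ x
  cancel = solve-∀

4∤ : ∀ {k} {4∤k : False (+ 4 ∣? k)} → ¬ (+ 4 ∣ k)
4∤ {4∤k = 4∤k} = toWitnessFalse 4∤k

-- A square is 0 or 1 modulo 4, so the odd ones among a, b, c are as many as among n.
quadruple-parity : ∀ {a b c n} → a * a + b * b + c * c ≡ n * n →
  (Even a × Even b × Even c) ⊎ (Odd a × Even b × Even c × Odd n) ⊎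
  (Even a × Odd b × Even c × Odd n) ⊎ (Even a × Even b × Odd c × Odd n)
quadruple-parity {a} {b} {c} {n} eq =
  classify (parity a) (parity b) (parity c) (parity n) (residues-balance (parity a) (parity b) (parity c) (parity n) eq)
  where
  classify : (pa : Even a ⊎ Odd a) (pb : Even b ⊎ Odd b) (pc : Even c ⊎ Odd c) (pn : Even n ⊎ Odd n) →
    + 4 ∣ residue pn - (residue pa + residue pb + residue pc) →
    (Even a × Even b × Even c) ⊎ (Odd a × Even b × Even c × Odd n) ⊎
    (Even a × Odd b × Even c × Odd n) ⊎ (Even a × Even b × Odd c × Odd n)
  classify (inj₁ ea) (inj₁ eb) (inj₁ ec) _         _ = inj₁ (ea , eb , ec)
  classify (inj₂ oa) (inj₁ eb) (inj₁ ec) (inj₂ on) _ = inj₂ (inj₁ (oa , eb , ec , on))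
  classify (inj₁ ea) (inj₂ ob) (inj₁ ec) (inj₂ on) _ = inj₂ (inj₂ (inj₁ (ea , ob , ec , on)))
  classify (inj₁ ea) (inj₁ eb) (inj₂ oc) (inj₂ on) _ = inj₂ (inj₂ (inj₂ (ea , eb , oc , on)))
  classify (inj₂ _) (inj₁ _) (inj₁ _) (inj₁ _) 4∣ = ⊥-elim (4∤ 4∣)
  classify (inj₁ _) (inj₂ _) (inj₁ _) (inj₁ _) 4∣ = ⊥-elim (4∤ 4∣)
  classify (inj₁ _) (inj₁ _) (inj₂ _) (inj₁ _) 4∣ = ⊥-elim (4∤ 4∣)
  classify (inj₂ _) (inj₂ _) (inj₁ _) (inj₁ _) 4∣ = ⊥-elim (4∤ 4∣)
  classify (inj₂ _) (inj₂ _) (inj₁ _) (inj₂ _) 4∣ = ⊥-elim (4∤ 4∣)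
  classify (inj₂ _) (inj₁ _) (inj₂ _) (inj₁ _) 4∣ = ⊥-elim (4∤ 4∣)
  classify (inj₂ _) (inj₁ _) (inj₂ _) (inj₂ _) 4∣ = ⊥-elim (4∤ 4∣)
  classify (inj₁ _) (inj₂ _) (inj₂ _) (inj₁ _) 4∣ = ⊥-elim (4∤ 4∣)
  classify (inj₁ _) (inj₂ _) (inj₂ _) (inj₂ _) 4∣ = ⊥-elim (4∤ 4∣)
  classify (inj₂ _) (inj₂ _) (inj₂ _) (inj₁ _) 4∣ = ⊥-elim (4∤ 4∣)
  classify (inj₂ _) (inj₂ _) (inj₂ _) (inj₂ _) 4∣ = ⊥-elim (4∤ 4∣)

-- Vectors of ℤ³

cong₃ : ∀ {A B C D : Set} (f : A → B → C → D) {a a′ b b′ c c′} → a ≡ a′ → b ≡ b′ → c ≡ c′ → f a b c ≡ f a′ b′ c′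
cong₃ f refl refl refl = refl

neg : ℤ³ → ℤ³
neg x = -1ℤ ·ᵥ x

neg-involutive : ∀ x → neg (neg x) ≡ x
neg-involutive x = cong₃ ⟨_,_,_⟩ (twice (x₁ x)) (twice (x₂ x)) (twice (x₃ x))
  where
  twice : ∀ a → -1ℤ * (-1ℤ * a) ≡ a
  twice = solve-∀

infix 4 _≡±_
_≡±_ : ℤ³ → ℤ³ → Set
x ≡± y = x ≡ y ⊎ x ≡ neg y

rotate : ℤ³ → ℤ³
rotate ⟨ a , b , c ⟩ = ⟨ b , c , a ⟩

lc : ℤ → ℤ → ℤ → ℤ³ → ℤ³ → ℤ³ → ℤ³
lc a b c p q r = (a ·ᵥ p) +ᵥ ((b ·ᵥ q) +ᵥ (c ·ᵥ r))

Span : ℤ³ → ℤ³ → ℤ³ → Pred ℤ³ 0ℓ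
Span p q r x = ∃[ a ] ∃[ b ] ∃[ c ] x ≡ lc a b c p q r

dot-comm : ∀ x y → dot x y ≡ dot y x
dot-comm ⟨ a , b , c ⟩ ⟨ d , e , f ⟩ = comm a b c d e f
  where
  comm : ∀ a b c d e f → a * d + b * e + c * f ≡ d * a + e * b + f * c
  comm = solve-∀

dot-+ˡ : ∀ x y z → dot (x +ᵥ y) z ≡ dot x z + dot y z
dot-+ˡ ⟨ a , b , c ⟩ ⟨ d , e , f ⟩ ⟨ g , h , i ⟩ = distrib a b c d e f g h i
  where
  distrib : ∀ a b c d e f g h i → (a + d) * g + (b + e) * h + (c + f) * i ≡ a * g + b * h + c * i + (d * g + e * h + f * i)
  distrib = solve-∀

dot-·ˡ : ∀ k x z → dot (k ·ᵥ x) z ≡ k * dot x z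
dot-·ˡ k ⟨ a , b , c ⟩ ⟨ g , h , i ⟩ = distrib k a b c g h i
  where
  distrib : ∀ k a b c g h i → k * a * g + k * b * h + k * c * i ≡ k * (a * g + b * h + c * i)
  distrib = solve-∀

dot-·ʳ : ∀ k x y → dot x (k ·ᵥ y) ≡ k * dot x y
dot-·ʳ k x y = trans (dot-comm x (k ·ᵥ y)) (trans (dot-·ˡ k y x) (cong (k *_) (dot-comm y x)))

dot-lcˡ : ∀ a b c p q r z → dot (lc a b c p q r) z ≡ a * dot p z + (b * dot q z + c * dot r z)
dot-lcˡ a b c p q r z = begin
  dot (lc a b c p q r) z                                        ≡⟨ dot-+ˡ (a ·ᵥ p) _ z ⟩
  dot (a ·ᵥ p) z + dot ((b ·ᵥ q) +ᵥ (c ·ᵥ r)) z                 ≡⟨ cong₂ _+_ (dot-·ˡ a p z) (dot-+ˡ (b ·ᵥ q) _ z) ⟩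
  a * dot p z + (dot (b ·ᵥ q) z + dot (c ·ᵥ r) z)               ≡⟨ cong (_+_ (a * dot p z)) (cong₂ _+_ (dot-·ˡ b q z) (dot-·ˡ c r z)) ⟩
  a * dot p z + (b * dot q z + c * dot r z)                     ∎
  where open ≡-Reasoning

dot-lcʳ : ∀ a b c p q r z → dot z (lc a b c p q r) ≡ a * dot z p + (b * dot z q + c * dot z r)
dot-lcʳ a b c p q r z = trans (dot-comm z _) (trans (dot-lcˡ a b c p q r z)
  (cong₂ _+_ (cong (a *_) (dot-comm p z)) (cong₂ _+_ (cong (b *_) (dot-comm q z)) (cong (c *_) (dot-comm r z)))))

dot-rotate : ∀ x y → dot (rotate x) (rotate y) ≡ dot x y
dot-rotate ⟨ a , b , c ⟩ ⟨ d , e , f ⟩ = cycle a b c d e f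
  where
  cycle : ∀ a b c d e f → b * e + c * f + a * d ≡ a * d + b * e + c * f
  cycle = solve-∀

dot-negʳ : ∀ x y → dot x (neg y) ≡ - dot x y
dot-negʳ x y = trans (dot-comm x (neg y)) (trans (dot-·ˡ -1ℤ y x) (trans (ℤₚ.-1*i≡-i (dot y x)) (cong -_ (dot-comm y x))))

lc-neg : ∀ a b c p q r → lc (- a) (- b) (- c) p q r ≡ neg (lc a b c p q r)
lc-neg a b c p q r =
  cong₃ ⟨_,_,_⟩ (negate a b c (x₁ p) (x₁ q) (x₁ r)) (negate a b c (x₂ p) (x₂ q) (x₂ r)) (negate a b c (x₃ p) (x₃ q) (x₃ r))
  where
  negate : ∀ a b c P Q R → - a * P + (- b * Q + - c * R) ≡ -1ℤ * (a * P + (b * Q + c * R))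
  negate = solve-∀

lc-e₁ : ∀ p q r → lc 1ℤ 0ℤ 0ℤ p q r ≡ p
lc-e₁ p q r = cong₃ ⟨_,_,_⟩ (pick (x₁ p) (x₁ q) (x₁ r)) (pick (x₂ p) (x₂ q) (x₂ r)) (pick (x₃ p) (x₃ q) (x₃ r))
  where
  pick : ∀ P Q R → 1ℤ * P + (0ℤ * Q + 0ℤ * R) ≡ P
  pick = solve-∀

lc-e₂ : ∀ p q r → lc 0ℤ 1ℤ 0ℤ p q r ≡ q
lc-e₂ p q r = cong₃ ⟨_,_,_⟩ (pick (x₁ p) (x₁ q) (x₁ r)) (pick (x₂ p) (x₂ q) (x₂ r)) (pick (x₃ p) (x₃ q) (x₃ r))
  where
  pick : ∀ P Q R → 0ℤ * P + (1ℤ * Q + 0ℤ * R) ≡ Q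
  pick = solve-∀

lc-e₃ : ∀ p q r → lc 0ℤ 0ℤ 1ℤ p q r ≡ r
lc-e₃ p q r = cong₃ ⟨_,_,_⟩ (pick (x₁ p) (x₁ q) (x₁ r)) (pick (x₂ p) (x₂ q) (x₂ r)) (pick (x₃ p) (x₃ q) (x₃ r))
  where
  pick : ∀ P Q R → 0ℤ * P + (0ℤ * Q + 1ℤ * R) ≡ R
  pick = solve-∀

lc-* : ∀ a b c k p q r → lc (a * k) (b * k) (c * k) p q r ≡ k ·ᵥ lc a b c p q r
lc-* a b c k p q r = cong₃ ⟨_,_,_⟩ (scale a b c k (x₁ p) (x₁ q) (x₁ r)) (scale a b c k (x₂ p) (x₂ q) (x₂ r)) (scale a b c k (x₃ p) (x₃ q) (x₃ r))
  where
  scale : ∀ a b c k P Q R → a * k * P + (b * k * Q + c * k * R) ≡ k * (a * P + (b * Q + c * R))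
  scale = solve-∀

·ᵥ-cancelˡ : ∀ k {x y} .{{_ : NonZero k}} → k ·ᵥ x ≡ k ·ᵥ y → x ≡ y
·ᵥ-cancelˡ k {x} {y} kx≡ky = cong₃ ⟨_,_,_⟩ (ℤₚ.*-cancelˡ-≡ k _ _ (cong x₁ kx≡ky))
  (ℤₚ.*-cancelˡ-≡ k _ _ (cong x₂ kx≡ky)) (ℤₚ.*-cancelˡ-≡ k _ _ (cong x₃ kx≡ky))

norm²-lc : ∀ a b c {p q r m} → norm² p ≡ m → norm² q ≡ m → norm² r ≡ m →
  dot p q ≡ 0ℤ → dot p r ≡ 0ℤ → dot q r ≡ 0ℤ → norm² (lc a b c p q r) ≡ m * norm² ⟨ a , b , c ⟩
norm²-lc a b c {p} {q} {r} {m} pp qq rr pq pr qr = begin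
  dot x x                                     ≡⟨ dot-lcˡ a b c p q r x ⟩
  a * dot p x + (b * dot q x + c * dot r x)   ≡⟨ cong₃ (λ u v w → a * u + (b * v + c * w)) px qx rx ⟩
  a * (a * m + (b * 0ℤ + c * 0ℤ)) + (b * (a * 0ℤ + (b * m + c * 0ℤ)) + c * (a * 0ℤ + (b * 0ℤ + c * m)))
                                              ≡⟨ collect a b c m ⟩
  m * norm² ⟨ a , b , c ⟩                     ∎
  where
  open ≡-Reasoning
  x = lc a b c p q r
  coefficient : ∀ u {α β γ} → dot u p ≡ α → dot u q ≡ β → dot u r ≡ γ → dot u x ≡ a * α + (b * β + c * γ)
  coefficient u up uq ur = trans (dot-lcʳ a b c p q r u) (cong₃ (λ α β γ → a * α + (b * β + c * γ)) up uq ur)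
  px = coefficient p pp pq pr
  qx = coefficient q (trans (dot-comm q p) pq) qq qr
  rx = coefficient r (trans (dot-comm r p) pr) (trans (dot-comm r q) qr) rr
  collect : ∀ a b c m → a * (a * m + (b * 0ℤ + c * 0ℤ)) + (b * (a * 0ℤ + (b * m + c * 0ℤ)) + c * (a * 0ℤ + (b * 0ℤ + c * m)))
          ≡ m * (a * a + b * b + c * c)
  collect = solve-∀

‖_‖² : ℤ³ → ℕ
‖ x ‖² = ∣ x₁ x ∣ ℕ.* ∣ x₁ x ∣ ℕ.+ ∣ x₂ x ∣ ℕ.* ∣ x₂ x ∣ ℕ.+ ∣ x₃ x ∣ ℕ.* ∣ x₃ x ∣

i*i≡∣i∣*∣i∣ : ∀ i → i * i ≡ + (∣ i ∣ ℕ.* ∣ i ∣)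
i*i≡∣i∣*∣i∣ (+ n)    = sym (ℤₚ.pos-* n n)
i*i≡∣i∣*∣i∣ -[1+ n ] = refl

norm²≡‖‖² : ∀ x → norm² x ≡ + ‖ x ‖²
norm²≡‖‖² x = cong₂ _+_ (cong₂ _+_ (i*i≡∣i∣*∣i∣ (x₁ x)) (i*i≡∣i∣*∣i∣ (x₂ x))) (i*i≡∣i∣*∣i∣ (x₃ x))

‖x‖²≡0⇒x≡0 : ∀ {x} → ‖ x ‖² ≡ 0 → x ≡ 0ᵥ
‖x‖²≡0⇒x≡0 {x} ‖x‖²≡0 = cong₃ ⟨_,_,_⟩
  (coordinate (x₁ x) (ℕₚ.m+n≡0⇒m≡0 _ (ℕₚ.m+n≡0⇒m≡0 _ ‖x‖²≡0)))
  (coordinate (x₂ x) (ℕₚ.m+n≡0⇒n≡0 (∣ x₁ x ∣ ℕ.* ∣ x₁ x ∣) (ℕₚ.m+n≡0⇒m≡0 _ ‖x‖²≡0)))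
  (coordinate (x₃ x) (ℕₚ.m+n≡0⇒n≡0 (∣ x₁ x ∣ ℕ.* ∣ x₁ x ∣ ℕ.+ ∣ x₂ x ∣ ℕ.* ∣ x₂ x ∣) ‖x‖²≡0))
  where
  coordinate : ∀ i → ∣ i ∣ ℕ.* ∣ i ∣ ≡ 0 → i ≡ 0ℤ
  coordinate (+ zero)    _  = refl
  coordinate (+ suc _)   ()
  coordinate -[1+ _ ]    ()

≤*norm² : ∀ n x → x ≢ 0ᵥ → + n ℤ.≤ + n * norm² x
≤*norm² n x x≢0 = subst (+ n ℤ.≤_) (trans (ℤₚ.pos-* n ‖ x ‖²) (cong (+ n *_) (sym (norm²≡‖‖² x))))
  (ℤ.+≤+ (ℕₚ.m≤m*n n ‖ x ‖² ⦃ ℕ.≢-nonZero (λ ‖x‖²≡0 → x≢0 (‖x‖²≡0⇒x≡0 ‖x‖²≡0)) ⦄))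

norm²-factor≡1 : ∀ {x y s} → norm² x ≢ 0ℤ → norm² x ≡ norm² y * norm² s → norm² x ℤ.≤ norm² y → norm² s ≡ 1ℤ
norm²-factor≡1 {x} {y} {s} |x|≢0 |x|≡|y||s| |x|≤|y| =
  trans (norm²≡‖‖² s) (cong +_ (n≡m*s∧n≤m⇒s≡1 (λ ‖x‖²≡0 → |x|≢0 (trans (norm²≡‖‖² x) (cong +_ ‖x‖²≡0)))
    (ℤₚ.+-injective (begin
      + ‖ x ‖²               ≡⟨ norm²≡‖‖² x ⟨
      norm² x                ≡⟨ |x|≡|y||s| ⟩
      norm² y * norm² s      ≡⟨ cong₂ _*_ (norm²≡‖‖² y) (norm²≡‖‖² s) ⟩
      + ‖ y ‖² * + ‖ s ‖²    ≡⟨ ℤₚ.pos-* ‖ y ‖² ‖ s ‖² ⟨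
      + (‖ y ‖² ℕ.* ‖ s ‖²)  ∎))
    (ℤₚ.drop‿+≤+ (subst₂ ℤ._≤_ (norm²≡‖‖² x) (norm²≡‖‖² y) |x|≤|y|))))
  where open ≡-Reasoning

norm²≡1 : ∀ {a b c} → norm² ⟨ a , b , c ⟩ ≡ 1ℤ →
  (Unit a × b ≡ 0ℤ × c ≡ 0ℤ) ⊎ (a ≡ 0ℤ × Unit b × c ≡ 0ℤ) ⊎ (a ≡ 0ℤ × b ≡ 0ℤ × Unit c)
norm²≡1 {a} {b} {c} unit with x*x+y*y+z*z≡1 (ℤₚ.+-injective (trans (sym (norm²≡‖‖² ⟨ a , b , c ⟩)) unit))
... | inj₁ (∣a∣≡1 , ∣b∣≡0 , ∣c∣≡0)        = inj₁ (∣i∣≡1⇒Unit ∣a∣≡1 , ∣i∣≡0⇒i≡0 ∣b∣≡0 , ∣i∣≡0⇒i≡0 ∣c∣≡0)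
... | inj₂ (inj₁ (∣a∣≡0 , ∣b∣≡1 , ∣c∣≡0)) = inj₂ (inj₁ (∣i∣≡0⇒i≡0 ∣a∣≡0 , ∣i∣≡1⇒Unit ∣b∣≡1 , ∣i∣≡0⇒i≡0 ∣c∣≡0))
... | inj₂ (inj₂ (∣a∣≡0 , ∣b∣≡0 , ∣c∣≡1)) = inj₂ (inj₂ (∣i∣≡0⇒i≡0 ∣a∣≡0 , ∣i∣≡0⇒i≡0 ∣b∣≡0 , ∣i∣≡1⇒Unit ∣c∣≡1))

lc-unit : ∀ {a b c} p q r → norm² ⟨ a , b , c ⟩ ≡ 1ℤ →
  lc a b c p q r ≡± p ⊎ lc a b c p q r ≡± q ⊎ lc a b c p q r ≡± r
lc-unit {a} {b} {c} p q r unit with norm²≡1 {a} {b} {c} unit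
... | inj₁ (inj₁ refl , refl , refl)        = inj₁ (inj₁ (lc-e₁ p q r))
... | inj₁ (inj₂ refl , refl , refl)        = inj₁ (inj₂ (trans (lc-neg 1ℤ 0ℤ 0ℤ p q r) (cong neg (lc-e₁ p q r))))
... | inj₂ (inj₁ (refl , inj₁ refl , refl)) = inj₂ (inj₁ (inj₁ (lc-e₂ p q r)))
... | inj₂ (inj₁ (refl , inj₂ refl , refl)) = inj₂ (inj₁ (inj₂ (trans (lc-neg 0ℤ 1ℤ 0ℤ p q r) (cong neg (lc-e₂ p q r)))))
... | inj₂ (inj₂ (refl , refl , inj₁ refl)) = inj₂ (inj₂ (inj₁ (lc-e₃ p q r)))
... | inj₂ (inj₂ (refl , refl , inj₂ refl)) = inj₂ (inj₂ (inj₂ (trans (lc-neg 0ℤ 0ℤ 1ℤ p q r) (cong neg (lc-e₃ p q r)))))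

≡±-sym : ∀ {x y} → x ≡± y → y ≡± x
≡±-sym (inj₁ refl) = inj₁ refl
≡±-sym {y = y} (inj₂ refl) = inj₂ (sym (neg-involutive y))

≡±-⊥ : ∀ {x y} z → x ≡± y → dot z y ≡ 0ℤ → dot z x ≡ 0ℤ
≡±-⊥ z (inj₁ refl) z⊥y = z⊥y
≡±-⊥ {y = y} z (inj₂ refl) z⊥y = trans (dot-negʳ z y) (cong -_ z⊥y)

≡±-orthogonal : ∀ {x y w} → x ≡± w → y ≡± w → dot x y ≡ 0ℤ → norm² w ≡ 0ℤ
≡±-orthogonal {x} {y} {w} x≡±w y≡±w x⊥y =
  ≡±-⊥ w (≡±-sym x≡±w) (trans (dot-comm w x) (≡±-⊥ x (≡±-sym y≡±w) x⊥y))

∈Span₁ : ∀ p q r → Span p q r p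
∈Span₁ p q r = 1ℤ , 0ℤ , 0ℤ , sym (lc-e₁ p q r)

∈Span₂ : ∀ p q r → Span p q r q
∈Span₂ p q r = 0ℤ , 1ℤ , 0ℤ , sym (lc-e₂ p q r)

∈Span₃ : ∀ p q r → Span p q r r
∈Span₃ p q r = 0ℤ , 0ℤ , 1ℤ , sym (lc-e₃ p q r)

Span-⊆ : ∀ {P Q R p q r} → Span P Q R p → Span P Q R q → Span P Q R r → Span p q r ⊆ Span P Q R
Span-⊆ {P} {Q} {R} (a₁ , b₁ , c₁ , refl) (a₂ , b₂ , c₂ , refl) (a₃ , b₃ , c₃ , refl) (a , b , c , refl) =
  a * a₁ + b * a₂ + c * a₃ , a * b₁ + b * b₂ + c * b₃ , a * c₁ + b * c₂ + c * c₃ ,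
  cong₃ ⟨_,_,_⟩ (substitute a b c a₁ b₁ c₁ a₂ b₂ c₂ a₃ b₃ c₃ (x₁ P) (x₁ Q) (x₁ R))
                (substitute a b c a₁ b₁ c₁ a₂ b₂ c₂ a₃ b₃ c₃ (x₂ P) (x₂ Q) (x₂ R))
                (substitute a b c a₁ b₁ c₁ a₂ b₂ c₂ a₃ b₃ c₃ (x₃ P) (x₃ Q) (x₃ R))
  where
  substitute : ∀ a b c a₁ b₁ c₁ a₂ b₂ c₂ a₃ b₃ c₃ P Q R →
    a * (a₁ * P + (b₁ * Q + c₁ * R)) + (b * (a₂ * P + (b₂ * Q + c₂ * R)) + c * (a₃ * P + (b₃ * Q + c₃ * R)))
    ≡ (a * a₁ + b * a₂ + c * a₃) * P + ((a * b₁ + b * b₂ + c * b₃) * Q + (a * c₁ + b * c₂ + c * c₃) * R)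
  substitute = solve-∀

Span-neg : ∀ {p q r x} → Span p q r x → Span p q r (neg x)
Span-neg {p} {q} {r} (a , b , c , refl) = - a , - b , - c , sym (lc-neg a b c p q r)

Span-± : ∀ {p q r x y} → x ≡± y → Span p q r y → Span p q r x
Span-± (inj₁ refl) y∈ = y∈
Span-± (inj₂ refl) y∈ = Span-neg y∈

Span-rotate : ∀ p q r → Span p q r ≐ Span q r p
Span-rotate p q r = rotation p q r , λ x∈ → rotation r p q (rotation q r p x∈)
  where
  rotation : ∀ p q r → Span p q r ⊆ Span q r p
  rotation p q r = Span-⊆ (∈Span₃ q r p) (∈Span₁ q r p) (∈Span₂ q r p)

record Coordinate : Set where
  field
    π : ℤ³ → ℤ
    π-· : ∀ k x → π (k ·ᵥ x) ≡ k * π x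
    π-lc : ∀ a b c p q r → π (lc a b c p q r) ≡ a * π p + (b * π q + c * π r)
    unit : ℤ³
    π-unit : π unit ≡ 1ℤ
    dot-unit : ∀ x → dot x unit ≡ π x

coordinate₁ coordinate₂ coordinate₃ : Coordinate
coordinate₁ = record { π = x₁ ; π-· = λ _ _ → refl ; π-lc = λ _ _ _ _ _ _ → refl
  ; unit = ⟨ 1ℤ , 0ℤ , 0ℤ ⟩ ; π-unit = refl ; dot-unit = λ x → pick (x₁ x) (x₂ x) (x₃ x) }
  where
  pick : ∀ a b c → a * 1ℤ + b * 0ℤ + c * 0ℤ ≡ a
  pick = solve-∀
coordinate₂ = record { π = x₂ ; π-· = λ _ _ → refl ; π-lc = λ _ _ _ _ _ _ → refl
  ; unit = ⟨ 0ℤ , 1ℤ , 0ℤ ⟩ ; π-unit = refl ; dot-unit = λ x → pick (x₁ x) (x₂ x) (x₃ x) }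
  where
  pick : ∀ a b c → a * 0ℤ + b * 1ℤ + c * 0ℤ ≡ b
  pick = solve-∀
coordinate₃ = record { π = x₃ ; π-· = λ _ _ → refl ; π-lc = λ _ _ _ _ _ _ → refl
  ; unit = ⟨ 0ℤ , 0ℤ , 1ℤ ⟩ ; π-unit = refl ; dot-unit = λ x → pick (x₁ x) (x₂ x) (x₃ x) }
  where
  pick : ∀ a b c → a * 0ℤ + b * 0ℤ + c * 1ℤ ≡ c
  pick = solve-∀

infix 4 _∣ᵥ_
_∣ᵥ_ : ℤ → ℤ³ → Set
k ∣ᵥ x = ∀ (i : Coordinate) → k ∣ Coordinate.π i x

∣ᵥ⇒∣dot : ∀ {k x} y → k ∣ᵥ x → k ∣ dot y x
∣ᵥ⇒∣dot y k∣x = ∣m∣n⇒∣m+n (∣m∣n⇒∣m+n (∣n⇒∣m*n (x₁ y) (k∣x coordinate₁)) (∣n⇒∣m*n (x₂ y) (k∣x coordinate₂)))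
                          (∣n⇒∣m*n (x₃ y) (k∣x coordinate₃))

-- Spinors of Pythagorean quadruples

-- With α = p + r i and β = s + t i: a = |α|² − |β|², b + c i = 2αβ̄, n = |α|² + |β|², and
-- the Gaussian integers α, β are coprime, witnessed by (e₁ + e₂ i)α + (f₁ + f₂ i)β = 1.
record Spinor (a b c : ℤ) (n : ℕ) : Set where
  field
    p r s t e₁ e₂ f₁ f₂ : ℤ
    a≡ : a ≡ p * p + r * r - s * s - t * t
    b≡ : b ≡ 2ℤ * (p * s + r * t)
    c≡ : c ≡ 2ℤ * (r * s - p * t)
    n≡ : + n ≡ p * p + r * r + s * s + t * t
    bézout-re : e₁ * p - e₂ * r + f₁ * s - f₂ * t ≡ 1ℤ
    bézout-im : e₁ * r + e₂ * p + f₁ * t + f₂ * s ≡ 0ℤ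

record NormalQuadruple (a b c : ℤ) (n : ℕ) : Set where
  field
    B C K : ℤ
    b≡2B : b ≡ 2ℤ * B
    c≡2C : c ≡ 2ℤ * C
    n≡a+2K : + n ≡ a + 2ℤ * K
    sum-of-squares : a * a + b * b + c * c ≡ + n * + n
    coprime : ∀ d → d ∣ a → d ∣ b → d ∣ c → d ∣ + n → d ∣ 1ℤ

NormalQuadruple-neg-a : ∀ {a b c n} → NormalQuadruple a b c n → NormalQuadruple (- a) b c n
NormalQuadruple-neg-a {a} {b} {c} q = record
  { B = B ; C = C ; K = K + a ; b≡2B = b≡2B ; c≡2C = c≡2C
  ; n≡a+2K = trans n≡a+2K (shift a K)
  ; sum-of-squares = trans (cong (λ x → x + b * b + c * c) (-i*-i≡i*i a)) sum-of-squares
  ; coprime = λ d d∣-a d∣b d∣c d∣n → coprime d (∣-i⇒∣i d∣-a) d∣b d∣c d∣n }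
  where
  open NormalQuadruple q
  shift : ∀ a K → a + 2ℤ * K ≡ - a + 2ℤ * (K + a)
  shift = solve-∀

NormalQuadruple-neg-b : ∀ {a b c n} → NormalQuadruple a b c n → NormalQuadruple a (- b) c n
NormalQuadruple-neg-b {a} {b} {c} q = record
  { B = - B ; C = C ; K = K ; c≡2C = c≡2C ; n≡a+2K = n≡a+2K
  ; b≡2B = trans (cong -_ b≡2B) (ℤₚ.neg-distribʳ-* 2ℤ B)
  ; sum-of-squares = trans (cong (λ x → a * a + x + c * c) (-i*-i≡i*i b)) sum-of-squares
  ; coprime = λ d d∣a d∣-b d∣c d∣n → coprime d d∣a (∣-i⇒∣i d∣-b) d∣c d∣n }
  where open NormalQuadruple q

NormalQuadruple-neg-c : ∀ {a b c n} → NormalQuadruple a b c n → NormalQuadruple a b (- c) n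
NormalQuadruple-neg-c {a} {b} {c} q = record
  { B = B ; C = - C ; K = K ; b≡2B = b≡2B ; n≡a+2K = n≡a+2K
  ; c≡2C = trans (cong -_ c≡2C) (ℤₚ.neg-distribʳ-* 2ℤ C)
  ; sum-of-squares = trans (cong (_+_ (a * a + b * b)) (-i*-i≡i*i c)) sum-of-squares
  ; coprime = λ d d∣a d∣b d∣-c d∣n → coprime d d∣a d∣b (∣-i⇒∣i d∣-c) d∣n }
  where open NormalQuadruple q

-- Negating a, b or c acts on spinors by (α, β) ↦ (β̄, ᾱ), (−ᾱ, β̄) or (ᾱ, β̄) respectively.
Spinor-neg-a : ∀ {a b c n} → Spinor (- a) b c n → Spinor a b c n
Spinor-neg-a {a} σ = record
  { p = s ; r = - t ; s = p ; t = - r ; e₁ = f₁ ; e₂ = - f₂ ; f₁ = e₁ ; f₂ = - e₂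
  ; a≡ = trans (sym (ℤₚ.neg-involutive a)) (trans (cong -_ a≡) (≡a p r s t))
  ; b≡ = trans b≡ (≡b p r s t)
  ; c≡ = trans c≡ (≡c p r s t)
  ; n≡ = trans n≡ (≡n p r s t)
  ; bézout-re = trans (≡re p r s t e₁ e₂ f₁ f₂) bézout-re
  ; bézout-im = trans (≡im p r s t e₁ e₂ f₁ f₂) (cong -_ bézout-im) }
  where
  open Spinor σ
  ≡a : ∀ p r s t → - (p * p + r * r - s * s - t * t) ≡ s * s + - t * - t - p * p - - r * - r
  ≡a = solve-∀
  ≡b : ∀ p r s t → 2ℤ * (p * s + r * t) ≡ 2ℤ * (s * p + - t * - r)
  ≡b = solve-∀
  ≡c : ∀ p r s t → 2ℤ * (r * s - p * t) ≡ 2ℤ * (- t * p - s * - r)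
  ≡c = solve-∀
  ≡n : ∀ p r s t → p * p + r * r + s * s + t * t ≡ s * s + - t * - t + p * p + - r * - r
  ≡n = solve-∀
  ≡re : ∀ p r s t e₁ e₂ f₁ f₂ → f₁ * s - - f₂ * - t + e₁ * p - - e₂ * - r ≡ e₁ * p - e₂ * r + f₁ * s - f₂ * t
  ≡re = solve-∀
  ≡im : ∀ p r s t e₁ e₂ f₁ f₂ → f₁ * - t + - f₂ * s + e₁ * - r + - e₂ * p ≡ - (e₁ * r + e₂ * p + f₁ * t + f₂ * s)
  ≡im = solve-∀

Spinor-neg-b : ∀ {a b c n} → Spinor a (- b) c n → Spinor a b c n
Spinor-neg-b {b = b} σ = record
  { p = - p ; r = r ; s = s ; t = - t ; e₁ = - e₁ ; e₂ = e₂ ; f₁ = f₁ ; f₂ = - f₂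
  ; a≡ = trans a≡ (≡a p r s t)
  ; b≡ = trans (sym (ℤₚ.neg-involutive b)) (trans (cong -_ b≡) (≡b p r s t))
  ; c≡ = trans c≡ (≡c p r s t)
  ; n≡ = trans n≡ (≡n p r s t)
  ; bézout-re = trans (≡re p r s t e₁ e₂ f₁ f₂) bézout-re
  ; bézout-im = trans (≡im p r s t e₁ e₂ f₁ f₂) (cong -_ bézout-im) }
  where
  open Spinor σ
  ≡a : ∀ p r s t → p * p + r * r - s * s - t * t ≡ - p * - p + r * r - s * s - - t * - t
  ≡a = solve-∀
  ≡b : ∀ p r s t → - (2ℤ * (p * s + r * t)) ≡ 2ℤ * (- p * s + r * - t)
  ≡b = solve-∀
  ≡c : ∀ p r s t → 2ℤ * (r * s - p * t) ≡ 2ℤ * (r * s - - p * - t)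
  ≡c = solve-∀
  ≡n : ∀ p r s t → p * p + r * r + s * s + t * t ≡ - p * - p + r * r + s * s + - t * - t
  ≡n = solve-∀
  ≡re : ∀ p r s t e₁ e₂ f₁ f₂ → - e₁ * - p - e₂ * r + f₁ * s - - f₂ * - t ≡ e₁ * p - e₂ * r + f₁ * s - f₂ * t
  ≡re = solve-∀
  ≡im : ∀ p r s t e₁ e₂ f₁ f₂ → - e₁ * r + e₂ * - p + f₁ * - t + - f₂ * s ≡ - (e₁ * r + e₂ * p + f₁ * t + f₂ * s)
  ≡im = solve-∀

Spinor-neg-c : ∀ {a b c n} → Spinor a b (- c) n → Spinor a b c n
Spinor-neg-c {c = c} σ = record
  { p = p ; r = - r ; s = s ; t = - t ; e₁ = e₁ ; e₂ = - e₂ ; f₁ = f₁ ; f₂ = - f₂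
  ; a≡ = trans a≡ (≡a p r s t)
  ; b≡ = trans b≡ (≡b p r s t)
  ; c≡ = trans (sym (ℤₚ.neg-involutive c)) (trans (cong -_ c≡) (≡c p r s t))
  ; n≡ = trans n≡ (≡n p r s t)
  ; bézout-re = trans (≡re p r s t e₁ e₂ f₁ f₂) bézout-re
  ; bézout-im = trans (≡im p r s t e₁ e₂ f₁ f₂) (cong -_ bézout-im) }
  where
  open Spinor σ
  ≡a : ∀ p r s t → p * p + r * r - s * s - t * t ≡ p * p + - r * - r - s * s - - t * - t
  ≡a = solve-∀
  ≡b : ∀ p r s t → 2ℤ * (p * s + r * t) ≡ 2ℤ * (p * s + - r * - t)
  ≡b = solve-∀
  ≡c : ∀ p r s t → - (2ℤ * (r * s - p * t)) ≡ 2ℤ * (- r * s - p * - t)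
  ≡c = solve-∀
  ≡n : ∀ p r s t → p * p + r * r + s * s + t * t ≡ p * p + - r * - r + s * s + - t * - t
  ≡n = solve-∀
  ≡re : ∀ p r s t e₁ e₂ f₁ f₂ → e₁ * p - - e₂ * - r + f₁ * s - - f₂ * - t ≡ e₁ * p - e₂ * r + f₁ * s - f₂ * t
  ≡re = solve-∀
  ≡im : ∀ p r s t e₁ e₂ f₁ f₂ → e₁ * - r + - e₂ * p + f₁ * - t + - f₂ * s ≡ - (e₁ * r + e₂ * p + f₁ * t + f₂ * s)
  ≡im = solve-∀

excess : ℤ → ℤ → ℤ → ℤ → ℤ
excess a b c n = a + b + c - n

cong₄ : ∀ {A B C D E : Set} (f : A → B → C → D → E) {a a′ b b′ c c′ d d′} →
  a ≡ a′ → b ≡ b′ → c ≡ c′ → d ≡ d′ → f a b c d ≡ f a′ b′ c′ d′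
cong₄ f refl refl refl refl = refl

-- The reflection x ↦ x − ⟨x, u⟩ u of the form a² + b² + c² − n² in u = (1, 1, 1, 1) acts on
-- spinors by (α, β) ↦ (ᾱ + (i − 1)β̄, iβ̄).
Spinor-reflect : ∀ {a′ b′ c′ n′} → Spinor a′ b′ c′ n′ → ∀ {a b c n} →
  a ≡ a′ - excess a′ b′ c′ (+ n′) → b ≡ b′ - excess a′ b′ c′ (+ n′) →
  c ≡ c′ - excess a′ b′ c′ (+ n′) → + n ≡ + n′ - excess a′ b′ c′ (+ n′) → Spinor a b c n
Spinor-reflect σ a≡′ b≡′ c≡′ n≡′ = record
  { p = p - s + t ; r = - r + s + t ; s = t ; t = s
  ; e₁ = e₁ ; e₂ = - e₂ ; f₁ = - (e₁ + e₂) - f₂ ; f₂ = - (e₁ - e₂) - f₁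
  ; a≡ = trans a≡′ (trans (cong₄ (λ x y z w → x - excess x y z w) a≡ b≡ c≡ n≡) (≡a p r s t))
  ; b≡ = trans b≡′ (trans (cong₄ (λ x y z w → y - excess x y z w) a≡ b≡ c≡ n≡) (≡b p r s t))
  ; c≡ = trans c≡′ (trans (cong₄ (λ x y z w → z - excess x y z w) a≡ b≡ c≡ n≡) (≡c p r s t))
  ; n≡ = trans n≡′ (trans (cong₄ (λ x y z w → w - excess x y z w) a≡ b≡ c≡ n≡) (≡n p r s t))
  ; bézout-re = trans (≡re p r s t e₁ e₂ f₁ f₂) bézout-re
  ; bézout-im = trans (≡im p r s t e₁ e₂ f₁ f₂) (cong -_ bézout-im) }
  where
  open Spinor σ
  ≡a : ∀ p r s t →
       (p * p + r * r - s * s - t * t)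
       - ((p * p + r * r - s * s - t * t) + 2ℤ * (p * s + r * t) + 2ℤ * (r * s - p * t) - (p * p + r * r + s * s + t * t))
     ≡ (p - s + t) * (p - s + t) + (- r + s + t) * (- r + s + t) - t * t - s * s
  ≡a = solve-∀
  ≡b : ∀ p r s t →
       (2ℤ * (p * s + r * t))
       - ((p * p + r * r - s * s - t * t) + 2ℤ * (p * s + r * t) + 2ℤ * (r * s - p * t) - (p * p + r * r + s * s + t * t))
     ≡ 2ℤ * ((p - s + t) * t + (- r + s + t) * s)
  ≡b = solve-∀
  ≡c : ∀ p r s t →
       (2ℤ * (r * s - p * t))
       - ((p * p + r * r - s * s - t * t) + 2ℤ * (p * s + r * t) + 2ℤ * (r * s - p * t) - (p * p + r * r + s * s + t * t))
     ≡ 2ℤ * ((- r + s + t) * t - (p - s + t) * s)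
  ≡c = solve-∀
  ≡n : ∀ p r s t →
       (p * p + r * r + s * s + t * t)
       - ((p * p + r * r - s * s - t * t) + 2ℤ * (p * s + r * t) + 2ℤ * (r * s - p * t) - (p * p + r * r + s * s + t * t))
     ≡ (p - s + t) * (p - s + t) + (- r + s + t) * (- r + s + t) + t * t + s * s
  ≡n = solve-∀
  ≡re : ∀ p r s t e₁ e₂ f₁ f₂ → e₁ * (p - s + t) - (- e₂) * (- r + s + t) + (- (e₁ + e₂) - f₂) * t - (- (e₁ - e₂) - f₁) * s
      ≡ e₁ * p - e₂ * r + f₁ * s - f₂ * t
  ≡re = solve-∀
  ≡im : ∀ p r s t e₁ e₂ f₁ f₂ → e₁ * (- r + s + t) + (- e₂) * (p - s + t) + (- (e₁ + e₂) - f₂) * s + (- (e₁ - e₂) - f₁) * t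
      ≡ - (e₁ * r + e₂ * p + f₁ * t + f₂ * s)
  ≡im = solve-∀

reflect-involutive : ∀ a b c n x → let e = excess a b c n in x ≡ (x - e) - excess (a - e) (b - e) (c - e) (n - e)
reflect-involutive = involution
  where
  involution : ∀ a b c n x → x ≡ (x - (a + b + c - n)) -
    ((a - (a + b + c - n)) + (b - (a + b + c - n)) + (c - (a + b + c - n)) - (n - (a + b + c - n)))
  involution = solve-∀

∣-excess : ∀ {d a b c n} → d ∣ a → d ∣ b → d ∣ c → d ∣ n → d ∣ excess a b c n
∣-excess d∣a d∣b d∣c d∣n = ∣m∣n⇒∣m-n (∣m∣n⇒∣m+n (∣m∣n⇒∣m+n d∣a d∣b) d∣c) d∣n

NormalQuadruple-reflect : ∀ {a b c n n′} → NormalQuadruple a b c n → let e = excess a b c (+ n) in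
  + n′ ≡ + n - e → NormalQuadruple (a - e) (b - e) (c - e) n′
NormalQuadruple-reflect {a} {b} {c} {n} {n′} q n′≡n-e = record
  { B = K - C ; C = K - B ; K = K
  ; b≡2B = trans (cong₃ (λ y z w → y - excess a y z w) b≡2B c≡2C n≡a+2K) (≡b a B C K)
  ; c≡2C = trans (cong₃ (λ y z w → z - excess a y z w) b≡2B c≡2C n≡a+2K) (≡c a B C K)
  ; n≡a+2K = trans n′≡n-e (trans (cong (λ w → w - excess a b c w) n≡a+2K)
      (trans (≡n a b c K) (cong (λ w → (a - excess a b c w) + 2ℤ * K) (sym n≡a+2K))))
  ; sum-of-squares = begin
      (a - e) * (a - e) + (b - e) * (b - e) + (c - e) * (c - e) ≡⟨ lorentz a b c (+ n) ⟩
      (a * a + b * b + c * c) - + n * + n + (+ n - e) * (+ n - e) ≡⟨ cong (λ x → x - + n * + n + (+ n - e) * (+ n - e)) sum-of-squares ⟩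
      + n * + n - + n * + n + (+ n - e) * (+ n - e)             ≡⟨ cancel (+ n * + n) _ ⟩
      (+ n - e) * (+ n - e)                                     ≡⟨ cong₂ _*_ n′≡n-e n′≡n-e ⟨
      + n′ * + n′                                               ∎
  ; coprime = λ d d∣a′ d∣b′ d∣c′ d∣n′ →
      let d∣n-e = subst (d ∣_) n′≡n-e d∣n′
          d∣e′ = ∣-excess d∣a′ d∣b′ d∣c′ d∣n-e
          back : ∀ {x} → d ∣ x - e → d ∣ x
          back {x} d∣x-e = subst (d ∣_) (sym (reflect-involutive a b c (+ n) x)) (∣m∣n⇒∣m-n d∣x-e d∣e′)
      in coprime d (back d∣a′) (back d∣b′) (back d∣c′) (back d∣n-e) }
  where
  open NormalQuadruple q
  open ≡-Reasoning
  e = excess a b c (+ n)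
  ≡b : ∀ a B C K → 2ℤ * B - (a + 2ℤ * B + 2ℤ * C - (a + 2ℤ * K)) ≡ 2ℤ * (K - C)
  ≡b = solve-∀
  ≡c : ∀ a B C K → 2ℤ * C - (a + 2ℤ * B + 2ℤ * C - (a + 2ℤ * K)) ≡ 2ℤ * (K - B)
  ≡c = solve-∀
  ≡n : ∀ a b c K → (a + 2ℤ * K) - (a + b + c - (a + 2ℤ * K)) ≡ (a - (a + b + c - (a + 2ℤ * K))) + 2ℤ * K
  ≡n = solve-∀
  lorentz : ∀ a b c n → (a - (a + b + c - n)) * (a - (a + b + c - n)) + (b - (a + b + c - n)) * (b - (a + b + c - n))
            + (c - (a + b + c - n)) * (c - (a + b + c - n))
          ≡ (a * a + b * b + c * c) - n * n + (n - (a + b + c - n)) * (n - (a + b + c - n))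
  lorentz = solve-∀
  cancel : ∀ x y → x - x + y ≡ y
  cancel = solve-∀

sum-of-squaresℕ : ∀ {a b c n} → NormalQuadruple (+ a) (+ b) (+ c) n → a ℕ.* a ℕ.+ b ℕ.* b ℕ.+ c ℕ.* c ≡ n ℕ.* n
sum-of-squaresℕ {a} {b} {c} {n} q = ℤₚ.+-injective (begin
  + (a ℕ.* a ℕ.+ b ℕ.* b ℕ.+ c ℕ.* c)   ≡⟨ cong₂ _+_ (cong₂ _+_ (ℤₚ.pos-* a a) (ℤₚ.pos-* b b)) (ℤₚ.pos-* c c) ⟩
  + a * + a + + b * + b + + c * + c     ≡⟨ NormalQuadruple.sum-of-squares q ⟩
  + n * + n                             ≡⟨ ℤₚ.pos-* n n ⟨
  + (n ℕ.* n)                           ∎)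
  where open ≡-Reasoning

-- (a + b + c)² ≤ n² = a² + b² + c² forces the cross terms to vanish; coprimality does the rest.
small-quadruple : ∀ {a b c n} → NormalQuadruple (+ a) (+ b) (+ c) n → a ℕ.+ b ℕ.+ c ℕ.≤ n →
  a ≡ 1 × b ≡ 0 × c ≡ 0 × n ≡ 1
small-quadruple {a} {b} {c} {n} q a+b+c≤n = a≡1 , b≡0 , c≡0 , n≡1
  where
  open NormalQuadruple q
  Q = a ℕ.* a ℕ.+ b ℕ.* b ℕ.+ c ℕ.* c
  cross = 2 ℕ.* (a ℕ.* b) ℕ.+ 2 ℕ.* (b ℕ.* c) ℕ.+ 2 ℕ.* (c ℕ.* a)
  expand : ∀ a b c → (a ℕ.+ b ℕ.+ c) ℕ.* (a ℕ.+ b ℕ.+ c)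
         ≡ (a ℕ.* a ℕ.+ b ℕ.* b ℕ.+ c ℕ.* c) ℕ.+ (2 ℕ.* (a ℕ.* b) ℕ.+ 2 ℕ.* (b ℕ.* c) ℕ.+ 2 ℕ.* (c ℕ.* a))
  expand = ℕRing.solve-∀
  cross≡0 : cross ≡ 0
  cross≡0 = ℕₚ.n≤0⇒n≡0 (ℕₚ.+-cancelˡ-≤ Q cross 0 (subst₂ ℕ._≤_ (expand a b c)
    (trans (sym (sum-of-squaresℕ q)) (sym (ℕₚ.+-identityʳ Q))) (ℕₚ.*-mono-≤ a+b+c≤n a+b+c≤n)))
  2x≡0⇒x≡0 : ∀ {x} → 2 ℕ.* x ≡ 0 → x ≡ 0
  2x≡0⇒x≡0 {x} 2x≡0 = ℕₚ.m*n≡0⇒m≡0 x 2 (trans (ℕₚ.*-comm x 2) 2x≡0)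
  a*b≡0 : a ℕ.* b ≡ 0
  a*b≡0 = 2x≡0⇒x≡0 (ℕₚ.m+n≡0⇒m≡0 _ (ℕₚ.m+n≡0⇒m≡0 _ cross≡0))
  c*a≡0 : c ℕ.* a ≡ 0
  c*a≡0 = 2x≡0⇒x≡0 (ℕₚ.m+n≡0⇒n≡0 (2 ℕ.* (a ℕ.* b) ℕ.+ 2 ℕ.* (b ℕ.* c)) cross≡0)
  a≢0 : a ≢ 0
  a≢0 refl = 2∤1 (coprime 2ℤ (divides 0ℤ refl) (divides B (trans b≡2B (ℤₚ.*-comm 2ℤ B)))
    (divides C (trans c≡2C (ℤₚ.*-comm 2ℤ C))) (divides K (trans n≡a+2K (trans (ℤₚ.+-identityˡ _) (ℤₚ.*-comm 2ℤ K)))))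
  b≡0 : b ≡ 0
  b≡0 with ℕₚ.m*n≡0⇒m≡0∨n≡0 a a*b≡0
  ... | inj₁ a≡0 = ⊥-elim (a≢0 a≡0)
  ... | inj₂ b≡0 = b≡0
  c≡0 : c ≡ 0
  c≡0 with ℕₚ.m*n≡0⇒m≡0∨n≡0 c c*a≡0
  ... | inj₁ c≡0 = c≡0
  ... | inj₂ a≡0 = ⊥-elim (a≢0 a≡0)
  a≡n : a ≡ n
  a≡n = m*m≡n*n⇒m≡n (trans (sym (only-a a b c b≡0 c≡0)) (sum-of-squaresℕ q))
    where
    only-a : ∀ a b c → b ≡ 0 → c ≡ 0 → a ℕ.* a ℕ.+ b ℕ.* b ℕ.+ c ℕ.* c ≡ a ℕ.* a
    only-a a .0 .0 refl refl = trans (ℕₚ.+-identityʳ _) (ℕₚ.+-identityʳ _)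
  n≡1 : n ≡ 1
  n≡1 = ℕᵈ.∣1⇒≡1 (∣⇒∣ᵤ (coprime (+ n) (subst (λ x → + n ∣ + x) (sym a≡n) ∣-refl)
    (subst (λ x → + n ∣ + x) (sym b≡0) (divides 0ℤ refl)) (subst (λ x → + n ∣ + x) (sym c≡0) (divides 0ℤ refl)) ∣-refl))
  a≡1 : a ≡ 1
  a≡1 = trans a≡n n≡1

Spinors : ℕ → Set
Spinors n = ∀ {a b c} → NormalQuadruple a b c n → Spinor a b c n

spinor-1000 : Spinor 1ℤ 0ℤ 0ℤ 1
spinor-1000 = record
  { p = 1ℤ ; r = 0ℤ ; s = 0ℤ ; t = 0ℤ ; e₁ = 1ℤ ; e₂ = 0ℤ ; f₁ = 0ℤ ; f₂ = 0ℤ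
  ; a≡ = refl ; b≡ = refl ; c≡ = refl ; n≡ = refl ; bézout-re = refl ; bézout-im = refl }

Spinor-cong : ∀ {a b c n a′ b′ c′ n′} → a ≡ a′ → b ≡ b′ → c ≡ c′ → n ≡ n′ → Spinor a b c n → Spinor a′ b′ c′ n′
Spinor-cong refl refl refl refl σ = σ

spinor-of-small : ∀ {a b c n} → NormalQuadruple (+ a) (+ b) (+ c) n → a ℕ.+ b ℕ.+ c ℕ.≤ n → Spinor (+ a) (+ b) (+ c) n
spinor-of-small q a+b+c≤n =
  let a≡1 , b≡0 , c≡0 , n≡1 = small-quadruple q a+b+c≤n
  in Spinor-cong (cong +_ (sym a≡1)) (cong +_ (sym b≡0)) (cong +_ (sym c≡0)) (sym n≡1) spinor-1000

descent : ∀ n → (∀ {m} → m ℕ.< n → Spinors m) →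
  ∀ a b c → NormalQuadruple (+ a) (+ b) (+ c) n → Spinor (+ a) (+ b) (+ c) n
descent n ih a b c q with a ℕ.+ b ℕ.+ c ℕ.≤? n
... | yes a+b+c≤n = spinor-of-small q a+b+c≤n
descent n ih a b c q | no a+b+c≰n with ℕₚ.m≤n⇒∃[o]m+o≡n (a+b+c≤2*n {a} {b} {c} {n} (sum-of-squaresℕ q))
... | n′ , a+b+c+n′≡2n = Spinor-reflect (ih n′<n (NormalQuadruple-reflect q n′≡n-e)) (back A refl) (back B refl) (back C refl) (back N n′≡n-e)
  where
  A = + a
  B = + b
  C = + c
  N = + n
  e = excess A B C N
  n′<n : n′ ℕ.< n
  n′<n = ℕₚ.+-cancelˡ-< n n′ n (subst (n ℕ.+ n′ ℕ.<_) (trans a+b+c+n′≡2n (cong (n ℕ.+_) (ℕₚ.+-identityʳ n)))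
           (ℕₚ.+-monoˡ-< n′ (ℕₚ.≰⇒> a+b+c≰n)))
  n′≡n-e : + n′ ≡ N - e
  n′≡n-e = trans (isolate (A + B + C) (+ n′)) (trans (cong (_- (A + B + C)) (cong +_ a+b+c+n′≡2n)) (twice (A + B + C) N))
    where
    isolate : ∀ S n′ → n′ ≡ (S + n′) - S
    isolate = solve-∀
    twice : ∀ S N → N + (N + 0ℤ) - S ≡ N - (S - N)
    twice = solve-∀
  back : ∀ x {x′} → x′ ≡ x - e → x ≡ x′ - excess (A - e) (B - e) (C - e) (+ n′)
  back x refl = trans (reflect-involutive A B C N x) (cong (λ w → (x - e) - excess (A - e) (B - e) (C - e) w) (sym n′≡n-e))

sign-symmetric : (P : ℤ → Set) → (∀ {i} → P (- i) → P i) → (∀ n → P (+ n)) → ∀ i → P i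
sign-symmetric P flip nonneg (+ n)    = nonneg n
sign-symmetric P flip nonneg -[1+ n ] = flip (nonneg (suc n))

spinor : ∀ {n} → Spinors n
spinor {n} = <-rec Spinors step n
  where
  step : ∀ n → (∀ {m} → m ℕ.< n → Spinors m) → Spinors n
  step n ih {a} {b} {c} =
    sign-symmetric (λ a → Solvable a b c) (λ f → Spinor-neg-a ∘ f ∘ NormalQuadruple-neg-a) (λ a →
    sign-symmetric (λ b → Solvable (+ a) b c) (λ f → Spinor-neg-b ∘ f ∘ NormalQuadruple-neg-b) (λ b →
    sign-symmetric (λ c → Solvable (+ a) (+ b) c) (λ f → Spinor-neg-c ∘ f ∘ NormalQuadruple-neg-c) (λ c →
    descent n ih a b c) c) b) a
    where
    Solvable : ℤ → ℤ → ℤ → Set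
    Solvable a b c = NormalQuadruple a b c n → Spinor a b c n

-- Adapted frames

-- Writing ω = w₁ + i w₂, the pairing fields say that (L + i M) · ω = 2: this is what makes
-- ±w₁ and ±w₂ the only integral vectors of norm |v|² orthogonal to v.
record AdaptedFrame (v : ℤ³) : Set where
  field
    w₁ w₂ : ℤ³
    |w₁|≡|v| : norm² w₁ ≡ norm² v
    |w₂|≡|v| : norm² w₂ ≡ norm² v
    w₁⊥w₂ : dot w₁ w₂ ≡ 0ℤ
    w₁⊥v : dot w₁ v ≡ 0ℤ
    w₂⊥v : dot w₂ v ≡ 0ℤ
    complete : ∀ x → norm² v ·ᵥ x ≡ lc (dot x w₁) (dot x w₂) (dot x v) w₁ w₂ v
    L M : ℤ³
    pairing-re : dot L w₁ - dot M w₂ ≡ 2ℤ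
    pairing-im : dot L w₂ + dot M w₁ ≡ 0ℤ
    |v|²-odd : Odd (norm² v)

AdaptedFrame-rotate : ∀ {v} → AdaptedFrame v → AdaptedFrame (rotate v)
AdaptedFrame-rotate {v} F = record
  { w₁ = rotate w₁ ; w₂ = rotate w₂ ; L = rotate L ; M = rotate M
  ; |w₁|≡|v| = trans (dot-rotate w₁ w₁) (trans |w₁|≡|v| (sym |v|≡))
  ; |w₂|≡|v| = trans (dot-rotate w₂ w₂) (trans |w₂|≡|v| (sym |v|≡))
  ; w₁⊥w₂ = trans (dot-rotate w₁ w₂) w₁⊥w₂
  ; w₁⊥v = trans (dot-rotate w₁ v) w₁⊥v
  ; w₂⊥v = trans (dot-rotate w₂ v) w₂⊥v
  ; complete = λ x → trans (cong (_·ᵥ x) |v|≡) (trans (cong rotate (complete (rotate (rotate x))))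
      (cong₃ (λ α β γ → lc α β γ (rotate w₁) (rotate w₂) (rotate v))
        (sym (dot-rotate (rotate (rotate x)) w₁)) (sym (dot-rotate (rotate (rotate x)) w₂)) (sym (dot-rotate (rotate (rotate x)) v))))
  ; pairing-re = trans (cong₂ _-_ (dot-rotate L w₁) (dot-rotate M w₂)) pairing-re
  ; pairing-im = trans (cong₂ _+_ (dot-rotate L w₂) (dot-rotate M w₁)) pairing-im
  ; |v|²-odd = let q , |v|²≡ = |v|²-odd in q , trans |v|≡ |v|²≡ }
  where
  open AdaptedFrame F
  |v|≡ : norm² (rotate v) ≡ norm² v
  |v|≡ = dot-rotate v v

-- With α, β as in Spinor, ε = e₁ + e₂ i and φ = f₁ + f₂ i: w₁ + i w₂ = (2αβ, β² − α², i(α² + β²))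
-- and L + i M = (2εφ, φ² − ε², −i(ε² + φ²)), whose bilinear pairing is 2(εα + φβ)² = 2.
adapted-frame : ∀ {a b c n} → Spinor a b c n → Odd (+ n) → AdaptedFrame ⟨ a , b , c ⟩
adapted-frame {a} {b} {c} {n} σ (k , n≡2k+1) = subst AdaptedFrame (sym (cong₃ ⟨_,_,_⟩ a≡ b≡ c≡)) (record
  { w₁ = W₁ ; w₂ = W₂ ; L = Lv ; M = Mv
  ; |w₁|≡|v| = trans (|w₁|² p r s t) (sym (|v|² p r s t))
  ; |w₂|≡|v| = trans (|w₂|² p r s t) (sym (|v|² p r s t))
  ; w₁⊥w₂ = w₁·w₂ p r s t
  ; w₁⊥v = w₁·v p r s t
  ; w₂⊥v = w₂·v p r s t
  ; complete = λ { ⟨ x , y , z ⟩ → trans (cong (_·ᵥ ⟨ x , y , z ⟩) (|v|² p r s t))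
      (cong₃ ⟨_,_,_⟩ (complete₁ p r s t x y z) (complete₂ p r s t x y z) (complete₃ p r s t x y z)) }
  ; pairing-re = trans (pairing-re′ p r s t e₁ e₂ f₁ f₂) (cong₂ (λ u w → 2ℤ * (u * u - w * w)) bézout-re bézout-im)
  ; pairing-im = trans (pairing-im′ p r s t e₁ e₂ f₁ f₂) (cong₂ (λ u w → 2ℤ * (2ℤ * (u * w))) bézout-re bézout-im)
  ; |v|²-odd = 2ℤ * k * k + 2ℤ * k ,
      trans (|v|² p r s t) (trans (cong₂ _*_ (trans (sym n≡) n≡2k+1) (trans (sym n≡) n≡2k+1)) (odd-square k)) })
  where
  open Spinor σ
  W₁ W₂ Lv Mv : ℤ³
  W₁ = ⟨ 2ℤ * (p * s - r * t) , s * s - t * t - p * p + r * r , - (2ℤ * (p * r + s * t)) ⟩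
  W₂ = ⟨ 2ℤ * (p * t + r * s) , 2ℤ * (s * t - p * r) , p * p - r * r + s * s - t * t ⟩
  Lv = ⟨ 2ℤ * (e₁ * f₁ - e₂ * f₂) , f₁ * f₁ - f₂ * f₂ - e₁ * e₁ + e₂ * e₂ , 2ℤ * (e₁ * e₂ + f₁ * f₂) ⟩
  Mv = ⟨ 2ℤ * (e₁ * f₂ + e₂ * f₁) , 2ℤ * (f₁ * f₂ - e₁ * e₂) , - (e₁ * e₁ - e₂ * e₂ + f₁ * f₁ - f₂ * f₂) ⟩
  odd-square : ∀ k → (2ℤ * k + 1ℤ) * (2ℤ * k + 1ℤ) ≡ 2ℤ * (2ℤ * k * k + 2ℤ * k) + 1ℤ
  odd-square = solve-∀
  |v|² : ∀ p r s t →
      (p * p + r * r - s * s - t * t) * (p * p + r * r - s * s - t * t) +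
      (2ℤ * (p * s + r * t)) * (2ℤ * (p * s + r * t)) +
      (2ℤ * (r * s - p * t)) * (2ℤ * (r * s - p * t))
    ≡ (p * p + r * r + s * s + t * t) * (p * p + r * r + s * s + t * t)
  |v|² = solve-∀
  |w₁|² : ∀ p r s t →
      (2ℤ * (p * s - r * t)) * (2ℤ * (p * s - r * t)) +
      (s * s - t * t - p * p + r * r) * (s * s - t * t - p * p + r * r) +
      (- (2ℤ * (p * r + s * t))) * (- (2ℤ * (p * r + s * t)))
    ≡ (p * p + r * r + s * s + t * t) * (p * p + r * r + s * s + t * t)
  |w₁|² = solve-∀
  |w₂|² : ∀ p r s t →
      (2ℤ * (p * t + r * s)) * (2ℤ * (p * t + r * s)) +
      (2ℤ * (s * t - p * r)) * (2ℤ * (s * t - p * r)) +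
      (p * p - r * r + s * s - t * t) * (p * p - r * r + s * s - t * t)
    ≡ (p * p + r * r + s * s + t * t) * (p * p + r * r + s * s + t * t)
  |w₂|² = solve-∀
  w₁·w₂ : ∀ p r s t →
      (2ℤ * (p * s - r * t)) * (2ℤ * (p * t + r * s)) +
      (s * s - t * t - p * p + r * r) * (2ℤ * (s * t - p * r)) +
      (- (2ℤ * (p * r + s * t))) * (p * p - r * r + s * s - t * t)
    ≡ 0ℤ
  w₁·w₂ = solve-∀
  w₁·v : ∀ p r s t →
      (2ℤ * (p * s - r * t)) * (p * p + r * r - s * s - t * t) +
      (s * s - t * t - p * p + r * r) * (2ℤ * (p * s + r * t)) +
      (- (2ℤ * (p * r + s * t))) * (2ℤ * (r * s - p * t))
    ≡ 0ℤ
  w₁·v = solve-∀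
  w₂·v : ∀ p r s t →
      (2ℤ * (p * t + r * s)) * (p * p + r * r - s * s - t * t) +
      (2ℤ * (s * t - p * r)) * (2ℤ * (p * s + r * t)) +
      (p * p - r * r + s * s - t * t) * (2ℤ * (r * s - p * t))
    ≡ 0ℤ
  w₂·v = solve-∀
  complete₁ : ∀ p r s t x y z →
      (p * p + r * r + s * s + t * t) * (p * p + r * r + s * s + t * t) * x
    ≡ (x * (2ℤ * (p * s - r * t)) +
        y * (s * s - t * t - p * p + r * r) +
        z * (- (2ℤ * (p * r + s * t)))) * (2ℤ * (p * s - r * t))
      + ((x * (2ℤ * (p * t + r * s)) +
        y * (2ℤ * (s * t - p * r)) +
        z * (p * p - r * r + s * s - t * t)) * (2ℤ * (p * t + r * s))
      + (x * (p * p + r * r - s * s - t * t) +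
        y * (2ℤ * (p * s + r * t)) +
        z * (2ℤ * (r * s - p * t))) * (p * p + r * r - s * s - t * t))
  complete₁ = solve-∀
  complete₂ : ∀ p r s t x y z →
      (p * p + r * r + s * s + t * t) * (p * p + r * r + s * s + t * t) * y
    ≡ (x * (2ℤ * (p * s - r * t)) +
        y * (s * s - t * t - p * p + r * r) +
        z * (- (2ℤ * (p * r + s * t)))) * (s * s - t * t - p * p + r * r)
      + ((x * (2ℤ * (p * t + r * s)) +
        y * (2ℤ * (s * t - p * r)) +
        z * (p * p - r * r + s * s - t * t)) * (2ℤ * (s * t - p * r))
      + (x * (p * p + r * r - s * s - t * t) +
        y * (2ℤ * (p * s + r * t)) +
        z * (2ℤ * (r * s - p * t))) * (2ℤ * (p * s + r * t)))
  complete₂ = solve-∀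
  complete₃ : ∀ p r s t x y z →
      (p * p + r * r + s * s + t * t) * (p * p + r * r + s * s + t * t) * z
    ≡ (x * (2ℤ * (p * s - r * t)) +
        y * (s * s - t * t - p * p + r * r) +
        z * (- (2ℤ * (p * r + s * t)))) * (- (2ℤ * (p * r + s * t)))
      + ((x * (2ℤ * (p * t + r * s)) +
        y * (2ℤ * (s * t - p * r)) +
        z * (p * p - r * r + s * s - t * t)) * (p * p - r * r + s * s - t * t)
      + (x * (p * p + r * r - s * s - t * t) +
        y * (2ℤ * (p * s + r * t)) +
        z * (2ℤ * (r * s - p * t))) * (2ℤ * (r * s - p * t)))
  complete₃ = solve-∀
  pairing-re′ : ∀ p r s t e₁ e₂ f₁ f₂ →
      ((2ℤ * (e₁ * f₁ - e₂ * f₂)) * (2ℤ * (p * s - r * t)) +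
      (f₁ * f₁ - f₂ * f₂ - e₁ * e₁ + e₂ * e₂) * (s * s - t * t - p * p + r * r) +
      (2ℤ * (e₁ * e₂ + f₁ * f₂)) * (- (2ℤ * (p * r + s * t))))
      - ((2ℤ * (e₁ * f₂ + e₂ * f₁)) * (2ℤ * (p * t + r * s)) +
      (2ℤ * (f₁ * f₂ - e₁ * e₂)) * (2ℤ * (s * t - p * r)) +
      (- (e₁ * e₁ - e₂ * e₂ + f₁ * f₁ - f₂ * f₂)) * (p * p - r * r + s * s - t * t))
    ≡ 2ℤ * ((e₁ * p - e₂ * r + f₁ * s - f₂ * t) * (e₁ * p - e₂ * r + f₁ * s - f₂ * t) - (e₁ * r + e₂ * p + f₁ * t + f₂ * s) * (e₁ * r + e₂ * p + f₁ * t + f₂ * s))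
  pairing-re′ = solve-∀
  pairing-im′ : ∀ p r s t e₁ e₂ f₁ f₂ →
      ((2ℤ * (e₁ * f₁ - e₂ * f₂)) * (2ℤ * (p * t + r * s)) +
      (f₁ * f₁ - f₂ * f₂ - e₁ * e₁ + e₂ * e₂) * (2ℤ * (s * t - p * r)) +
      (2ℤ * (e₁ * e₂ + f₁ * f₂)) * (p * p - r * r + s * s - t * t))
      + ((2ℤ * (e₁ * f₂ + e₂ * f₁)) * (2ℤ * (p * s - r * t)) +
      (2ℤ * (f₁ * f₂ - e₁ * e₂)) * (s * s - t * t - p * p + r * r) +
      (- (e₁ * e₁ - e₂ * e₂ + f₁ * f₁ - f₂ * f₂)) * (- (2ℤ * (p * r + s * t))))
    ≡ 2ℤ * (2ℤ * ((e₁ * p - e₂ * r + f₁ * s - f₂ * t) * (e₁ * r + e₂ * p + f₁ * t + f₂ * s)))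
  pairing-im′ = solve-∀

Coprime₃ : ℤ³ → Set
Coprime₃ v = ∀ d → d ∣ x₁ v → d ∣ x₂ v → d ∣ x₃ v → d ∣ 1ℤ

Primitive⇒Coprime₃ : ∀ v → Primitive v → Coprime₃ v
Primitive⇒Coprime₃ v gcd≡1 d d∣a d∣b d∣c =
  ∣ᵤ⇒∣ (subst (∣ d ∣ ℕᵈ.∣_) gcd≡1 (ℕᵍ.gcd-greatest (ℕᵍ.gcd-greatest (∣⇒∣ᵤ d∣a) (∣⇒∣ᵤ d∣b)) (∣⇒∣ᵤ d∣c)))

adapted-frame-odd₁ : ∀ {a b c n} → Odd a → Even b → Even c → Odd (+ n) →
  norm² ⟨ a , b , c ⟩ ≡ + n * + n → Coprime₃ ⟨ a , b , c ⟩ → AdaptedFrame ⟨ a , b , c ⟩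
adapted-frame-odd₁ {a} {b} {c} {n} (qa , a≡) (qb , b≡) (qc , c≡) odd-n@(qn , n≡) sum-of-squares coprime =
  adapted-frame (spinor quadruple) odd-n
  where
  quadruple : NormalQuadruple a b c n
  quadruple = record
    { B = qb ; C = qc ; K = qn - qa ; b≡2B = b≡ ; c≡2C = c≡
    ; n≡a+2K = trans n≡ (trans (shift qa qn) (cong (λ x → x + 2ℤ * (qn - qa)) (sym a≡)))
    ; sum-of-squares = sum-of-squares
    ; coprime = λ d d∣a d∣b d∣c _ → coprime d d∣a d∣b d∣c }
    where
    shift : ∀ qa qn → 2ℤ * qn + 1ℤ ≡ 2ℤ * qa + 1ℤ + 2ℤ * (qn - qa)
    shift = solve-∀

adapted-frame-exists : ∀ {v} n → norm² v ≡ + n * + n → Coprime₃ v → AdaptedFrame v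
adapted-frame-exists {v} n sum-of-squares coprime =
  by-parity (quadruple-parity {x₁ v} {x₂ v} {x₃ v} {+ n} sum-of-squares)
  where
  by-parity : (Even (x₁ v) × Even (x₂ v) × Even (x₃ v)) ⊎ (Odd (x₁ v) × Even (x₂ v) × Even (x₃ v) × Odd (+ n)) ⊎
    (Even (x₁ v) × Odd (x₂ v) × Even (x₃ v) × Odd (+ n)) ⊎ (Even (x₁ v) × Even (x₂ v) × Odd (x₃ v) × Odd (+ n)) →
    AdaptedFrame v
  by-parity (inj₁ (even-a , even-b , even-c)) = ⊥-elim (2∤1 (coprime 2ℤ (Even⇒2∣ even-a) (Even⇒2∣ even-b) (Even⇒2∣ even-c)))
  by-parity (inj₂ (inj₁ (odd-a , even-b , even-c , odd-n))) = adapted-frame-odd₁ odd-a even-b even-c odd-n sum-of-squares coprime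
  by-parity (inj₂ (inj₂ (inj₁ (even-a , odd-b , even-c , odd-n)))) =
    AdaptedFrame-rotate (AdaptedFrame-rotate (adapted-frame-odd₁ odd-b even-c even-a odd-n
      (trans (dot-rotate v v) sum-of-squares) (λ d d∣b d∣c d∣a → coprime d d∣a d∣b d∣c)))
  by-parity (inj₂ (inj₂ (inj₂ (even-a , even-b , odd-c , odd-n)))) =
    AdaptedFrame-rotate (adapted-frame-odd₁ odd-c even-a even-b odd-n
      (trans (dot-rotate (rotate v) (rotate v)) (trans (dot-rotate v v) sum-of-squares)) (λ d d∣c d∣a d∣b → coprime d d∣a d∣b d∣c))

-- The cubic lattice of an adapted frame

gaussian-divisibility : ∀ {N D E a b c g} → D * D + E * E ≡ N * N → N ≡ a * a + (b * b + c * c) →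
  N * g ≡ D * a + (E * b + 0ℤ * c) → N ∣ - E * a + (D * b + 0ℤ * c)
gaussian-divisibility {N} {D} {E} {a} {b} {c} {g} D²+E²≡N² N≡ Ng≡ = i*i∣j*j⇒i∣j (divides (N - c * c - g * g) (begin
  Y * Y                                                      ≡⟨ lagrange D E a b c ⟩
  (D * D + E * E) * (a * a + b * b) - X * X                  ≡⟨ cong₂ (λ s x → s * (a * a + b * b) - x * x) D²+E²≡N² (sym Ng≡) ⟩
  N * N * (a * a + b * b) - N * g * (N * g)                  ≡⟨ collect N a b c g ⟩
  (a * a + (b * b + c * c) - c * c - g * g) * (N * N)        ≡⟨ cong (λ n → (n - c * c - g * g) * (N * N)) N≡ ⟨
  (N - c * c - g * g) * (N * N)                              ∎))
  where
  open ≡-Reasoning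
  X = D * a + (E * b + 0ℤ * c)
  Y = - E * a + (D * b + 0ℤ * c)
  lagrange : ∀ D E a b c → (- E * a + (D * b + 0ℤ * c)) * (- E * a + (D * b + 0ℤ * c))
           ≡ (D * D + E * E) * (a * a + b * b) - (D * a + (E * b + 0ℤ * c)) * (D * a + (E * b + 0ℤ * c))
  lagrange = solve-∀
  collect : ∀ N a b c g → N * N * (a * a + b * b) - N * g * (N * g) ≡ (a * a + (b * b + c * c) - c * c - g * g) * (N * N)
  collect = solve-∀

module _ {v : ℤ³} (F : AdaptedFrame v) where
  open AdaptedFrame F

  private
    N : ℤ
    N = norm² v

  |v|²≢0 : norm² v ≢ 0ℤ
  |v|²≢0 N≡0 = let k , N≡2k+1 = |v|²-odd in 2*i+1≢0 k (trans (sym N≡2k+1) N≡0)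

  private instance
    N-nonZero : NonZero N
    N-nonZero = ℤ.≢-nonZero |v|²≢0

  column-norm : ∀ (i : Coordinate) → let open Coordinate i in N ≡ π w₁ * π w₁ + (π w₂ * π w₂ + π v * π v)
  column-norm i = begin
    N                                                              ≡⟨ ℤₚ.*-identityʳ N ⟨
    N * 1ℤ                                                         ≡⟨ cong (N *_) π-unit ⟨
    N * π unit                                                     ≡⟨ π-· N unit ⟨
    π (N ·ᵥ unit)                                                  ≡⟨ cong π (complete unit) ⟩
    π (lc (dot unit w₁) (dot unit w₂) (dot unit v) w₁ w₂ v)        ≡⟨ π-lc (dot unit w₁) (dot unit w₂) (dot unit v) w₁ w₂ v ⟩
    dot unit w₁ * π w₁ + (dot unit w₂ * π w₂ + dot unit v * π v)   ≡⟨ cong₃ (λ α β γ → α * π w₁ + (β * π w₂ + γ * π v)) (πw w₁) (πw w₂) (πw v) ⟩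
    π w₁ * π w₁ + (π w₂ * π w₂ + π v * π v)                        ∎
    where
    open Coordinate i
    open ≡-Reasoning
    πw : ∀ w → dot unit w ≡ π w
    πw w = trans (dot-comm unit w) (dot-unit w)

  pairing-re-lc : ∀ D E → dot L (lc D E 0ℤ w₁ w₂ v) - dot M (lc (- E) D 0ℤ w₁ w₂ v) ≡ 2ℤ * D
  pairing-re-lc D E = begin
    dot L (lc D E 0ℤ w₁ w₂ v) - dot M (lc (- E) D 0ℤ w₁ w₂ v)
      ≡⟨ cong₂ _-_ (dot-lcʳ D E 0ℤ w₁ w₂ v L) (dot-lcʳ (- E) D 0ℤ w₁ w₂ v M) ⟩
    D * dot L w₁ + (E * dot L w₂ + 0ℤ) - (- E * dot M w₁ + (D * dot M w₂ + 0ℤ))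
      ≡⟨ regroup D E (dot L w₁) (dot L w₂) (dot M w₁) (dot M w₂) ⟩
    D * (dot L w₁ - dot M w₂) + E * (dot L w₂ + dot M w₁)
      ≡⟨ cong₂ (λ re im → D * re + E * im) pairing-re pairing-im ⟩
    D * 2ℤ + E * 0ℤ
      ≡⟨ tidy D E ⟩
    2ℤ * D ∎
    where
    open ≡-Reasoning
    regroup : ∀ D E l₁ l₂ m₁ m₂ → D * l₁ + (E * l₂ + 0ℤ) - (- E * m₁ + (D * m₂ + 0ℤ)) ≡ D * (l₁ - m₂) + E * (l₂ + m₁)
    regroup = solve-∀
    tidy : ∀ D E → D * 2ℤ + E * 0ℤ ≡ 2ℤ * D
    tidy = solve-∀

  pairing-im-lc : ∀ D E → dot L (lc (- E) D 0ℤ w₁ w₂ v) + dot M (lc D E 0ℤ w₁ w₂ v) ≡ - (2ℤ * E)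
  pairing-im-lc D E = begin
    dot L (lc (- E) D 0ℤ w₁ w₂ v) + dot M (lc D E 0ℤ w₁ w₂ v)
      ≡⟨ cong₂ _+_ (dot-lcʳ (- E) D 0ℤ w₁ w₂ v L) (dot-lcʳ D E 0ℤ w₁ w₂ v M) ⟩
    - E * dot L w₁ + (D * dot L w₂ + 0ℤ) + (D * dot M w₁ + (E * dot M w₂ + 0ℤ))
      ≡⟨ regroup D E (dot L w₁) (dot L w₂) (dot M w₁) (dot M w₂) ⟩
    D * (dot L w₂ + dot M w₁) - E * (dot L w₁ - dot M w₂)
      ≡⟨ cong₂ (λ im re → D * im - E * re) pairing-im pairing-re ⟩
    D * 0ℤ - E * 2ℤ
      ≡⟨ tidy D E ⟩
    - (2ℤ * E) ∎
    where
    open ≡-Reasoning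
    regroup : ∀ D E l₁ l₂ m₁ m₂ → - E * l₁ + (D * l₂ + 0ℤ) + (D * m₁ + (E * m₂ + 0ℤ)) ≡ D * (l₂ + m₁) - E * (l₁ - m₂)
    regroup = solve-∀
    tidy : ∀ D E → D * 0ℤ - E * 2ℤ ≡ - (2ℤ * E)
    tidy = solve-∀

  |v|²∣2*i⇒∣i : ∀ {i} → N ∣ 2ℤ * i → N ∣ i
  |v|²∣2*i⇒∣i {i} N∣2i = let k , N≡2k+1 = |v|²-odd in
    subst (_∣ i) (sym N≡2k+1) (odd∣2*i⇒∣i k (subst (_∣ 2ℤ * i) N≡2k+1 N∣2i))

  -- With D = g·w₁ and E = g·w₂, completeness gives N g = X := D w₁ + E w₂, and Lagrange's identity
  -- shows that N also divides the coordinates of Y := D w₂ − E w₁. Pairing X, Y with L, M yields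
  -- N ∣ 2D and N ∣ 2E, so (D, E) = N (d, e) with d² + e² = 1.
  orthogonal-axes : ∀ g → dot g v ≡ 0ℤ → norm² g ≡ norm² v → g ≡± w₁ ⊎ g ≡± w₂
  orthogonal-axes g g⊥v |g|≡|v| = axes N∣D N∣E
    where
    D = dot g w₁
    E = dot g w₂
    X = lc D E 0ℤ w₁ w₂ v
    Y = lc (- E) D 0ℤ w₁ w₂ v
    Ng≡X : N ·ᵥ g ≡ X
    Ng≡X = trans (complete g) (cong (λ z → lc D E z w₁ w₂ v) g⊥v)
    D²+E²≡N² : D * D + E * E ≡ N * N
    D²+E²≡N² = begin
      D * D + E * E                         ≡⟨ cong (_+_ (D * D)) (ℤₚ.+-identityʳ (E * E)) ⟨
      D * D + (E * E + 0ℤ * dot g v)        ≡⟨ dot-lcʳ D E 0ℤ w₁ w₂ v g ⟨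
      dot g X                               ≡⟨ cong (dot g) Ng≡X ⟨
      dot g (N ·ᵥ g)                        ≡⟨ dot-·ʳ N g g ⟩
      N * norm² g                           ≡⟨ cong (N *_) |g|≡|v| ⟩
      N * N                                 ∎
      where open ≡-Reasoning
    N∣X : N ∣ᵥ X
    N∣X i = divides (π g) (trans (sym (cong π Ng≡X)) (trans (π-· N g) (ℤₚ.*-comm N (π g))))
      where open Coordinate i
    N∣Y : N ∣ᵥ Y
    N∣Y i = subst (N ∣_) (sym (π-lc (- E) D 0ℤ w₁ w₂ v))
      (gaussian-divisibility {N} {D} {E} {π w₁} {π w₂} {π v} {π g} D²+E²≡N² (column-norm i)
        (trans (sym (π-· N g)) (trans (cong π Ng≡X) (π-lc D E 0ℤ w₁ w₂ v))))
      where open Coordinate i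
    N∣D : N ∣ D
    N∣D = |v|²∣2*i⇒∣i (subst (N ∣_) (pairing-re-lc D E) (∣m∣n⇒∣m-n (∣ᵥ⇒∣dot L N∣X) (∣ᵥ⇒∣dot M N∣Y)))
    N∣E : N ∣ E
    N∣E = |v|²∣2*i⇒∣i (∣-i⇒∣i (subst (N ∣_) (pairing-im-lc D E) (∣m∣n⇒∣m+n (∣ᵥ⇒∣dot L N∣Y) (∣ᵥ⇒∣dot M N∣X))))
    d²+e²≡1 : ∀ d e → D ≡ d * N → E ≡ e * N → norm² ⟨ d , e , 0ℤ ⟩ ≡ 1ℤ
    d²+e²≡1 d e D≡dN E≡eN = ℤₚ.*-cancelˡ-≡ (N * N) _ 1ℤ ⦃ ℤₚ.i*j≢0 N N ⦄ (begin
      N * N * (d * d + e * e + 0ℤ)     ≡⟨ expand N d e ⟩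
      d * N * (d * N) + e * N * (e * N) ≡⟨ cong₂ (λ x y → x * x + y * y) D≡dN E≡eN ⟨
      D * D + E * E                     ≡⟨ D²+E²≡N² ⟩
      N * N                             ≡⟨ ℤₚ.*-identityʳ (N * N) ⟨
      N * N * 1ℤ                        ∎)
      where
      open ≡-Reasoning
      expand : ∀ N d e → N * N * (d * d + e * e + 0ℤ) ≡ d * N * (d * N) + e * N * (e * N)
      expand = solve-∀
    g≡ : ∀ d e → D ≡ d * N → E ≡ e * N → g ≡ lc d e 0ℤ w₁ w₂ v
    g≡ d e D≡dN E≡eN = ·ᵥ-cancelˡ N (trans Ng≡X (trans (cong₂ (λ α β → lc α β 0ℤ w₁ w₂ v) D≡dN E≡eN) (lc-* d e 0ℤ N w₁ w₂ v)))
    axes : N ∣ D → N ∣ E → g ≡± w₁ ⊎ g ≡± w₂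
    axes (divides d D≡dN) (divides e E≡eN) =
      on-axes (g≡ d e D≡dN E≡eN) (lc-unit {d} {e} {0ℤ} w₁ w₂ v (d²+e²≡1 d e D≡dN E≡eN))
      where
      on-axes : ∀ {x} → g ≡ x → x ≡± w₁ ⊎ x ≡± w₂ ⊎ x ≡± v → g ≡± w₁ ⊎ g ≡± w₂
      on-axes refl (inj₁ g≡±w₁)        = inj₁ g≡±w₁
      on-axes refl (inj₂ (inj₁ g≡±w₂)) = inj₂ g≡±w₂
      on-axes refl (inj₂ (inj₂ g≡±v))  = ⊥-elim (|v|²≢0 (≡±-⊥ v (≡±-sym g≡±v) (trans (dot-comm v g) g⊥v)))

  |x|≡|v|⇒x≢0 : ∀ {x} → norm² x ≡ norm² v → x ≢ 0ᵥ
  |x|≡|v|⇒x≢0 |x|≡|v| refl = |v|²≢0 (sym |x|≡|v|)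

  cubic-frame : CubicFrame
  cubic-frame = record
    { u₁ = w₁ ; u₂ = w₂ ; u₃ = v
    ; u₁≢0 = |x|≡|v|⇒x≢0 |w₁|≡|v| ; u₂≢0 = |x|≡|v|⇒x≢0 |w₂|≡|v| ; u₃≢0 = |x|≡|v|⇒x≢0 refl
    ; u₁⊥u₂ = w₁⊥w₂ ; u₁⊥u₃ = w₁⊥v ; u₂⊥u₃ = w₂⊥v
    ; |u₁|≡|u₂| = trans |w₁|≡|v| (sym |w₂|≡|v|) ; |u₁|≡|u₃| = |w₁|≡|v| }

  shortest : ShortestIn v cubic-frame
  shortest = ∈Span₃ w₁ w₂ v , |x|≡|v|⇒x≢0 refl , λ { x (a , b , c , refl) x≢0 → begin
    N                                ≡⟨ norm²≡‖‖² v ⟩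
    + ‖ v ‖²                         ≤⟨ ≤*norm² ‖ v ‖² ⟨ a , b , c ⟩ (λ abc≡0 → x≢0 (cong (λ u → lc (x₁ u) (x₂ u) (x₃ u) w₁ w₂ v) abc≡0)) ⟩
    + ‖ v ‖² * norm² ⟨ a , b , c ⟩   ≡⟨ cong (_* norm² ⟨ a , b , c ⟩) (norm²≡‖‖² v) ⟨
    N * norm² ⟨ a , b , c ⟩          ≡⟨ norm²-lc a b c |w₁|≡|v| |w₂|≡|v| refl w₁⊥w₂ w₁⊥v w₂⊥v ⟨
    norm² x                          ∎ }
    where open ℤₚ.≤-Reasoning

  span-≐ : ∀ {g₁ g₂ g₃} → dot g₁ g₂ ≡ 0ℤ → dot g₁ v ≡ 0ℤ → dot g₂ v ≡ 0ℤ →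
    norm² g₁ ≡ norm² v → norm² g₂ ≡ norm² v → g₃ ≡± v → Span w₁ w₂ v ≐ Span g₁ g₂ g₃
  span-≐ {g₁} {g₂} {g₃} g₁⊥g₂ g₁⊥v g₂⊥v |g₁|≡|v| |g₂|≡|v| g₃≡±v =
    pair (orthogonal-axes g₁ g₁⊥v |g₁|≡|v|) (orthogonal-axes g₂ g₂⊥v |g₂|≡|v|)
    where
    spanned : Span g₁ g₂ g₃ ⊆ Span w₁ w₂ v → Span w₁ w₂ v ⊆ Span g₁ g₂ g₃ → Span w₁ w₂ v ≐ Span g₁ g₂ g₃
    spanned ⊇ ⊆ = ⊆ , ⊇
    v∈ : Span g₁ g₂ g₃ v
    v∈ = Span-± (≡±-sym g₃≡±v) (∈Span₃ g₁ g₂ g₃)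
    g₃∈ : Span w₁ w₂ v g₃
    g₃∈ = Span-± g₃≡±v (∈Span₃ w₁ w₂ v)
    pair : g₁ ≡± w₁ ⊎ g₁ ≡± w₂ → g₂ ≡± w₁ ⊎ g₂ ≡± w₂ → Span w₁ w₂ v ≐ Span g₁ g₂ g₃
    pair (inj₁ g₁≡±w₁) (inj₁ g₂≡±w₁) = ⊥-elim (|v|²≢0 (trans (sym |w₁|≡|v|) (≡±-orthogonal g₁≡±w₁ g₂≡±w₁ g₁⊥g₂)))
    pair (inj₂ g₁≡±w₂) (inj₂ g₂≡±w₂) = ⊥-elim (|v|²≢0 (trans (sym |w₂|≡|v|) (≡±-orthogonal g₁≡±w₂ g₂≡±w₂ g₁⊥g₂)))
    pair (inj₁ g₁≡±w₁) (inj₂ g₂≡±w₂) = spanned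
      (Span-⊆ (Span-± g₁≡±w₁ (∈Span₁ w₁ w₂ v)) (Span-± g₂≡±w₂ (∈Span₂ w₁ w₂ v)) g₃∈)
      (Span-⊆ (Span-± (≡±-sym g₁≡±w₁) (∈Span₁ g₁ g₂ g₃)) (Span-± (≡±-sym g₂≡±w₂) (∈Span₂ g₁ g₂ g₃)) v∈)
    pair (inj₂ g₁≡±w₂) (inj₁ g₂≡±w₁) = spanned
      (Span-⊆ (Span-± g₁≡±w₂ (∈Span₂ w₁ w₂ v)) (Span-± g₂≡±w₁ (∈Span₁ w₁ w₂ v)) g₃∈)
      (Span-⊆ (Span-± (≡±-sym g₂≡±w₁) (∈Span₂ g₁ g₂ g₃)) (Span-± (≡±-sym g₁≡±w₂) (∈Span₁ g₁ g₂ g₃)) v∈)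

  unique : ∀ G → ShortestIn v G → SameLattice cubic-frame G
  unique G ((a , b , c , v≡) , _ , v-shortest) x = (λ x∈F → proj₁ same-span x∈F) , (λ x∈G → proj₂ same-span x∈G)
    where
    g₁ = u₁ G
    g₂ = u₂ G
    g₃ = u₃ G
    |v|≡|g₁|*S : norm² v ≡ norm² g₁ * norm² ⟨ a , b , c ⟩
    |v|≡|g₁|*S = trans (cong norm² v≡) (norm²-lc a b c refl (sym (|u₁|≡|u₂| G)) (sym (|u₁|≡|u₃| G)) (u₁⊥u₂ G) (u₁⊥u₃ G) (u₂⊥u₃ G))
    S≡1 : norm² ⟨ a , b , c ⟩ ≡ 1ℤ
    S≡1 = norm²-factor≡1 {v} {g₁} {⟨ a , b , c ⟩} |v|²≢0 |v|≡|g₁|*S (v-shortest g₁ (∈Span₁ g₁ g₂ g₃) (u₁≢0 G))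
    |g₁|≡|v| : norm² g₁ ≡ norm² v
    |g₁|≡|v| = sym (trans |v|≡|g₁|*S (trans (cong (norm² g₁ *_) S≡1) (ℤₚ.*-identityʳ (norm² g₁))))
    |g₂|≡|v| : norm² g₂ ≡ norm² v
    |g₂|≡|v| = trans (sym (|u₁|≡|u₂| G)) |g₁|≡|v|
    |g₃|≡|v| : norm² g₃ ≡ norm² v
    |g₃|≡|v| = trans (sym (|u₁|≡|u₃| G)) |g₁|≡|v|
    via-generator : v ≡± g₁ ⊎ v ≡± g₂ ⊎ v ≡± g₃ → Span w₁ w₂ v ≐ Span g₁ g₂ g₃
    via-generator (inj₁ v≡±g₁) = ≐-trans
      (span-≐ (u₂⊥u₃ G) (≡±-⊥ g₂ v≡±g₁ (trans (dot-comm g₂ g₁) (u₁⊥u₂ G))) (≡±-⊥ g₃ v≡±g₁ (trans (dot-comm g₃ g₁) (u₁⊥u₃ G)))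
        |g₂|≡|v| |g₃|≡|v| (≡±-sym v≡±g₁))
      (≐-sym (Span-rotate g₁ g₂ g₃))
    via-generator (inj₂ (inj₁ v≡±g₂)) = ≐-trans
      (span-≐ (trans (dot-comm g₃ g₁) (u₁⊥u₃ G)) (≡±-⊥ g₃ v≡±g₂ (trans (dot-comm g₃ g₂) (u₂⊥u₃ G))) (≡±-⊥ g₁ v≡±g₂ (u₁⊥u₂ G))
        |g₃|≡|v| |g₁|≡|v| (≡±-sym v≡±g₂))
      (Span-rotate g₃ g₁ g₂)
    via-generator (inj₂ (inj₂ v≡±g₃)) =
      span-≐ (u₁⊥u₂ G) (≡±-⊥ g₁ v≡±g₃ (u₁⊥u₃ G)) (≡±-⊥ g₂ v≡±g₃ (u₂⊥u₃ G)) |g₁|≡|v| |g₂|≡|v| (≡±-sym v≡±g₃)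
    same-span : Span w₁ w₂ v ≐ Span g₁ g₂ g₃
    same-span = via-generator (subst (λ u → u ≡± g₁ ⊎ u ≡± g₂ ⊎ u ≡± g₃) (sym v≡) (lc-unit {a} {b} {c} g₁ g₂ g₃ S≡1))

corollary7p5 : (v : ℤ³) → Primitive v → IntegralLength v →
    ∃[ F ] (ShortestIn v F × (∀ G → ShortestIn v G → SameLattice F G))
corollary7p5 v v-primitive (n , |v|²≡n²) = cubic-frame F , shortest F , unique F
  where
  F : AdaptedFrame v
  F = adapted-frame-exists n (trans |v|²≡n² (ℤₚ.pos-* n n)) (Primitive⇒Coprime₃ v v-primitive)
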